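{- Let $p$ be an odd prime, let $\sigma \in \{1,-1\}$, $\alpha \in \mathbb{F}_p$, and let $a_1,a_2,a_3 \in \mathbb{F}_p$ satisfy, for some index $i \in \{1,2,3\}$ (indices modulo $3$), $a_i = 2\sigma$, $a_{i-1} = \alpha$, $a_{i+1} = \alpha\sigma$. Assume $s := 3+a_1+a_2+a_3 \neq 0$ in $\mathbb{F}_p$. Let $S \subseteq \mathbb{F}_p^3$ be the set of solutions of \[ x_1^2+x_2^2+x_3^2+a_1x_2x_3+a_2x_1x_3+a_3x_1x_2 = s\,x_1x_2x_3, \] and for $j \in \{1,2,3\}$ let $m_j: S\to S$ replace $x_j$ by $-x_j + s x_{j-1}x_{j+1} - a_{j+1}x_{j-1} - a_{j-1}x_{j+1}$ (indices modulo $3$), leaving the other coordinates unchanged. Then $S \setminus \{(0,0,0)\}$ is a union of at least two orbits of the group generated by $m_1,m_2,m_3$. If moreover $\alpha \in \{2,-2\}$ (so that $(a_1,a_2,a_3)$ is one of $(2,2,2)$, $(2,-2,-2)$, $(-2,2,-2)$, $(-2,-2,2)$), then $S\setminus\{(0,0,0)\}$ is a union of at least four orbits.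
   Context: The point $(0,0,0)$ lies in $S$ and forms an orbit on its own.
   Formalization: The formal theorem assumes in addition p ≠ 3; for p = 3 the claim is false: with σ = 1, α = 0, (a₁,a₂,a₃) = (2,0,0) the set S∖{(0,0,0)} is a single orbit, and for α = ±2 with s ≠ 0 there are only three orbits. -}

module Defs where

open import Algebra.Bundles using (CommutativeRing)
open import Data.Fin using (Fin; toℕ)
open import Data.Fin.Patterns using (0F; 1F; 2F)
open import Data.Fin.Properties using (toℕ-fromℕ<; fromℕ<-cong; fromℕ<-toℕ; toℕ<n; toℕ≤n)
open import Data.Irrelevant using (map)
open import Data.Nat as ℕ using (ℕ; NonZero; _∸_)
open import Data.Nat.DivMod using (_%_; _mod_; m%n<n; n%n≡0; m<n⇒m%n≡m; %-distribˡ-+; %-distribˡ-*)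
import Data.Nat.Properties as ℕ
open import Data.Product using (∃-syntax; Σ-syntax; _×_; _,_)
open import Data.Refinement using (Refinement; _,_; value)
open import Data.Vec using (Vec; []; _∷_; lookup; replicate; _[_]≔_)
open import Function using (_∘_; _↔_; Inverse; mk↔ₛ′)
open import Function.Construct.Composition using (_↔-∘_)
open import Function.Construct.Identity using (↔-id)
open import Function.Construct.Symmetry using (↔-sym)
open import Level using (0ℓ)
open import Relation.Binary.PropositionalEquality using (_≡_; _≢_; refl; sym; trans; cong; cong₂; isEquivalence; module ≡-Reasoning)
open import Relation.Nullary using (¬_)
open import Relation.Unary using (Pred; _≐_; ⋃)

import Algebra.Properties.AbelianGroup as AbelianGroupProperties
import Algebra.Solver.Ring.NaturalCoefficients.Default as SemiringSolver

𝔽 : ℕ → Set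
𝔽 p = Fin p

module _ {p : ℕ} .{{_ : NonZero p}} where

  infix  8 -_
  infixl 7 _*_
  infixl 6 _+_ _-_

  ⌜_⌝ : ℕ → 𝔽 p
  ⌜ n ⌝ = n mod p

  _+_ _*_ : 𝔽 p → 𝔽 p → 𝔽 p
  x + y = ⌜ toℕ x ℕ.+ toℕ y ⌝
  x * y = ⌜ toℕ x ℕ.* toℕ y ⌝

  -_ : 𝔽 p → 𝔽 p
  - x = ⌜ p ∸ toℕ x ⌝

  _-_ : 𝔽 p → 𝔽 p → 𝔽 p
  x - y = x + - y

module _ (p : ℕ) .{{_ : NonZero p}} where

  private
    ⌜⌝-cong : ∀ {m n} → m % p ≡ n % p → ⌜ m ⌝ ≡ ⌜ n ⌝
    ⌜⌝-cong {m} {n} eq = fromℕ<-cong (m % p) (n % p) eq (m%n<n m p) (m%n<n n p)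

    toℕ-⌜⌝ : ∀ n → toℕ {p} ⌜ n ⌝ ≡ n % p
    toℕ-⌜⌝ n = toℕ-fromℕ< (m%n<n n p)

    ⌜toℕ⌝ : ∀ (x : 𝔽 p) → ⌜ toℕ x ⌝ ≡ x
    ⌜toℕ⌝ x = trans
      (fromℕ<-cong _ _ (m<n⇒m%n≡m (toℕ<n x)) (m%n<n (toℕ x) p) (toℕ<n x))
      (fromℕ<-toℕ x (toℕ<n x))

    ⌜⌝-+ : ∀ m n → ⌜ m ⌝ + ⌜ n ⌝ ≡ ⌜ m ℕ.+ n ⌝
    ⌜⌝-+ m n = trans (cong₂ (λ a b → ⌜ a ℕ.+ b ⌝) (toℕ-⌜⌝ m) (toℕ-⌜⌝ n))
                     (⌜⌝-cong (sym (%-distribˡ-+ m n p)))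

    ⌜⌝-* : ∀ m n → ⌜ m ⌝ * ⌜ n ⌝ ≡ ⌜ m ℕ.* n ⌝
    ⌜⌝-* m n = trans (cong₂ (λ a b → ⌜ a ℕ.* b ⌝) (toℕ-⌜⌝ m) (toℕ-⌜⌝ n))
                     (⌜⌝-cong (sym (%-distribˡ-* m n p)))

    +-assoc : ∀ (x y z : 𝔽 p) → x + y + z ≡ x + (y + z)
    +-assoc x y z = begin
      x + y + z                          ≡⟨ cong (x + y +_) (⌜toℕ⌝ z) ⟨
      x + y + ⌜ toℕ z ⌝                  ≡⟨ ⌜⌝-+ (toℕ x ℕ.+ toℕ y) (toℕ z) ⟩
      ⌜ toℕ x ℕ.+ toℕ y ℕ.+ toℕ z ⌝      ≡⟨ cong ⌜_⌝ (ℕ.+-assoc (toℕ x) _ _) ⟩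
      ⌜ toℕ x ℕ.+ (toℕ y ℕ.+ toℕ z) ⌝    ≡⟨ ⌜⌝-+ (toℕ x) (toℕ y ℕ.+ toℕ z) ⟨
      ⌜ toℕ x ⌝ + (y + z)                ≡⟨ cong (_+ (y + z)) (⌜toℕ⌝ x) ⟩
      x + (y + z)                        ∎
      where open ≡-Reasoning

    *-assoc : ∀ (x y z : 𝔽 p) → x * y * z ≡ x * (y * z)
    *-assoc x y z = begin
      x * y * z                          ≡⟨ cong (x * y *_) (⌜toℕ⌝ z) ⟨
      x * y * ⌜ toℕ z ⌝                  ≡⟨ ⌜⌝-* (toℕ x ℕ.* toℕ y) (toℕ z) ⟩
      ⌜ toℕ x ℕ.* toℕ y ℕ.* toℕ z ⌝      ≡⟨ cong ⌜_⌝ (ℕ.*-assoc (toℕ x) _ _) ⟩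
      ⌜ toℕ x ℕ.* (toℕ y ℕ.* toℕ z) ⌝    ≡⟨ ⌜⌝-* (toℕ x) (toℕ y ℕ.* toℕ z) ⟨
      ⌜ toℕ x ⌝ * (y * z)                ≡⟨ cong (_* (y * z)) (⌜toℕ⌝ x) ⟩
      x * (y * z)                        ∎
      where open ≡-Reasoning

    +-comm : ∀ (x y : 𝔽 p) → x + y ≡ y + x
    +-comm x y = cong ⌜_⌝ (ℕ.+-comm (toℕ x) (toℕ y))

    *-comm : ∀ (x y : 𝔽 p) → x * y ≡ y * x
    *-comm x y = cong ⌜_⌝ (ℕ.*-comm (toℕ x) (toℕ y))

    +-identityˡ : ∀ (x : 𝔽 p) → ⌜ 0 ⌝ + x ≡ x
    +-identityˡ x = begin
      ⌜ 0 ⌝ + x          ≡⟨ cong (⌜ 0 ⌝ +_) (⌜toℕ⌝ x) ⟨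
      ⌜ 0 ⌝ + ⌜ toℕ x ⌝  ≡⟨ ⌜⌝-+ 0 (toℕ x) ⟩
      ⌜ toℕ x ⌝          ≡⟨ ⌜toℕ⌝ x ⟩
      x                  ∎
      where open ≡-Reasoning

    *-identityˡ : ∀ (x : 𝔽 p) → ⌜ 1 ⌝ * x ≡ x
    *-identityˡ x = begin
      ⌜ 1 ⌝ * x          ≡⟨ cong (⌜ 1 ⌝ *_) (⌜toℕ⌝ x) ⟨
      ⌜ 1 ⌝ * ⌜ toℕ x ⌝  ≡⟨ ⌜⌝-* 1 (toℕ x) ⟩
      ⌜ 1 ℕ.* toℕ x ⌝    ≡⟨ cong ⌜_⌝ (ℕ.*-identityˡ (toℕ x)) ⟩
      ⌜ toℕ x ⌝          ≡⟨ ⌜toℕ⌝ x ⟩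
      x                  ∎
      where open ≡-Reasoning

    -‿inverseˡ : ∀ (x : 𝔽 p) → - x + x ≡ ⌜ 0 ⌝
    -‿inverseˡ x = begin
      - x + x                          ≡⟨ cong (- x +_) (⌜toℕ⌝ x) ⟨
      ⌜ p ∸ toℕ x ⌝ + ⌜ toℕ x ⌝        ≡⟨ ⌜⌝-+ (p ∸ toℕ x) (toℕ x) ⟩
      ⌜ p ∸ toℕ x ℕ.+ toℕ x ⌝          ≡⟨ cong ⌜_⌝ (ℕ.m∸n+n≡m (toℕ≤n x)) ⟩
      ⌜ p ⌝                            ≡⟨ ⌜⌝-cong (trans (n%n≡0 p) (sym (m<n⇒m%n≡m (ℕ.>-nonZero⁻¹ p)))) ⟩
      ⌜ 0 ⌝                            ∎
      where open ≡-Reasoning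

    *-distribˡ-+ : ∀ (x y z : 𝔽 p) → x * (y + z) ≡ x * y + x * z
    *-distribˡ-+ x y z = begin
      x * (y + z)                                      ≡⟨ cong (_* (y + z)) (⌜toℕ⌝ x) ⟨
      ⌜ toℕ x ⌝ * (y + z)                              ≡⟨ ⌜⌝-* (toℕ x) (toℕ y ℕ.+ toℕ z) ⟩
      ⌜ toℕ x ℕ.* (toℕ y ℕ.+ toℕ z) ⌝                  ≡⟨ cong ⌜_⌝ (ℕ.*-distribˡ-+ (toℕ x) _ _) ⟩
      ⌜ toℕ x ℕ.* toℕ y ℕ.+ toℕ x ℕ.* toℕ z ⌝          ≡⟨ ⌜⌝-+ (toℕ x ℕ.* toℕ y) (toℕ x ℕ.* toℕ z) ⟨
      x * y + x * z                                    ∎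
      where open ≡-Reasoning

    comm⇒ʳ : ∀ {_∙_ : 𝔽 p → 𝔽 p → 𝔽 p} {e : 𝔽 p} → (∀ x y → x ∙ y ≡ y ∙ x) →
             (∀ x → e ∙ x ≡ x) → ∀ x → x ∙ e ≡ x
    comm⇒ʳ comm idˡ x = trans (comm x _) (idˡ x)

  𝔽-commutativeRing : CommutativeRing 0ℓ 0ℓ
  𝔽-commutativeRing = record
    { Carrier = 𝔽 p ; _≈_ = _≡_ ; _+_ = _+_ ; _*_ = _*_ ; -_ = λ x → - x
    ; 0# = ⌜ 0 ⌝ ; 1# = ⌜ 1 ⌝
    ; isCommutativeRing = record
      { isRing = record
        { +-isAbelianGroup = record
          { isGroup = record
            { isMonoid = record
              { isSemigroup = record
                { isMagma = record { isEquivalence = isEquivalence ; ∙-cong = cong₂ _+_ }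
                ; assoc = +-assoc }
              ; identity = +-identityˡ , comm⇒ʳ +-comm +-identityˡ }
            ; inverse = -‿inverseˡ , λ x → trans (+-comm x (- x)) (-‿inverseˡ x)
            ; ⁻¹-cong = cong (λ x → - x) }
          ; comm = +-comm }
        ; *-cong = cong₂ _*_
        ; *-assoc = *-assoc
        ; *-identity = *-identityˡ , comm⇒ʳ *-comm *-identityˡ
        ; distrib = *-distribˡ-+ , λ x y z → begin
            (y + z) * x    ≡⟨ *-comm (y + z) x ⟩
            x * (y + z)    ≡⟨ *-distribˡ-+ x y z ⟩
            x * y + x * z  ≡⟨ cong₂ _+_ (*-comm x y) (*-comm x z) ⟩
            y * x + z * x  ∎ }
      ; *-comm = *-comm } }
    where open ≡-Reasoning

-- The indices 1, 2, 3 (taken modulo 3) are 0F, 1F, 2F.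
next prev : Fin 3 → Fin 3
next 0F = 1F
next 1F = 2F
next 2F = 0F
prev 0F = 2F
prev 1F = 0F
prev 2F = 1F

Triple : ℕ → Set
Triple p = Vec (𝔽 p) 3

module _ {p : ℕ} .{{_ : NonZero p}} where

  coeff-s : Triple p → 𝔽 p
  coeff-s (a₁ ∷ a₂ ∷ a₃ ∷ []) = ⌜ 3 ⌝ + a₁ + a₂ + a₃

  Solves : Triple p → Triple p → Set
  Solves a@(a₁ ∷ a₂ ∷ a₃ ∷ []) (x₁ ∷ x₂ ∷ x₃ ∷ []) =
    x₁ * x₁ + x₂ * x₂ + x₃ * x₃ + a₁ * x₂ * x₃ + a₂ * x₁ * x₃ + a₃ * x₁ * x₂
      ≡ coeff-s a * x₁ * x₂ * x₃

  newCoord : Triple p → Fin 3 → Triple p → 𝔽 p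
  newCoord a j x =
    - lookup x j + coeff-s a * lookup x (prev j) * lookup x (next j)
      - lookup a (next j) * lookup x (prev j) - lookup a (prev j) * lookup x (next j)

  moveTriple : Triple p → Fin 3 → Triple p → Triple p
  moveTriple a j x = x [ j ]≔ newCoord a j x

  private
    R = 𝔽-commutativeRing p
    open CommutativeRing R using (+-assoc; +-comm; +-identityˡ; -‿inverseʳ)
    open AbelianGroupProperties (CommutativeRing.+-abelianGroup R)
      using () renaming (∙-cancelʳ to +-cancelʳ; ∙-cancelˡ to +-cancelˡ)
    open SemiringSolver (CommutativeRing.commutativeSemiring R)

    -- x′ is the new coordinate in a move, with d = s x_{j-1} x_{j+1},
    -- b = a_{j+1} x_{j-1} and c = a_{j-1} x_{j+1}.
    vieta-sum : ∀ x d b c → let x′ = - x + d - b - c in x + x′ + (b + c) ≡ d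
    vieta-sum x d b c = begin
      x + (- x + d + - b + - c) + (b + c)          ≡⟨ solve 7 (λ x x⁻ d b b⁻ c c⁻ →
        x :+ (x⁻ :+ d :+ b⁻ :+ c⁻) :+ (b :+ c) := (x :+ x⁻) :+ ((b :+ b⁻) :+ ((c :+ c⁻) :+ d)))
        refl x (- x) d b (- b) c (- c) ⟩
      (x + - x) + ((b + - b) + ((c + - c) + d))    ≡⟨ cong₂ _+_ (-‿inverseʳ x)
        (cong₂ _+_ (-‿inverseʳ b) (cong (_+ d) (-‿inverseʳ c))) ⟩
      ⌜ 0 ⌝ + (⌜ 0 ⌝ + (⌜ 0 ⌝ + d))                ≡⟨ trans (+-identityˡ _) (trans (+-identityˡ _) (+-identityˡ _)) ⟩
      d                                            ∎
      where open ≡-Reasoning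

    vieta-involutive : ∀ x d b c → let x′ = - x + d - b - c in - x′ + d - b - c ≡ x
    vieta-involutive x d b c = sym (+-cancelʳ (b + c) _ _ (+-cancelˡ x′ _ _ (begin
      x′ + (x + (b + c))                        ≡⟨ +-assoc x′ x (b + c) ⟨
      x′ + x + (b + c)                          ≡⟨ cong (_+ (b + c)) (+-comm x′ x) ⟩
      x + x′ + (b + c)                          ≡⟨ vieta-sum x d b c ⟩
      d                                         ≡⟨ vieta-sum x′ d b c ⟨
      x′ + (- x′ + d - b - c) + (b + c)         ≡⟨ +-assoc x′ _ (b + c) ⟩
      x′ + ((- x′ + d - b - c) + (b + c))       ∎)))
      where
      open ≡-Reasoning
      x′ = - x + d - b - c

    -- x and x′ are the two roots of X² + (b + c) X + r = d X.
    vieta-root : ∀ x d b c r → let x′ = - x + d - b - c in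
                 x * x + x * (b + c) + r ≡ d * x → x′ * x′ + x′ * (b + c) + r ≡ d * x′
    vieta-root x d b c r eq = begin
      x′ * x′ + x′ * w + r          ≡⟨ cong (x′ * x′ + x′ * w +_) r≡xx′ ⟩
      x′ * x′ + x′ * w + x * x′     ≡⟨ solve 3 (λ x x′ w →
        x′ :* x′ :+ x′ :* w :+ x :* x′ := (x :+ x′ :+ w) :* x′) refl x x′ w ⟩
      (x + x′ + w) * x′             ≡⟨ cong (_* x′) (vieta-sum x d b c) ⟩
      d * x′                        ∎
      where
      open ≡-Reasoning
      x′ = - x + d - b - c
      w = b + c
      r≡xx′ : r ≡ x * x′
      r≡xx′ = +-cancelˡ (x * x + x * w) _ _ (begin
        x * x + x * w + r           ≡⟨ eq ⟩
        d * x                       ≡⟨ cong (_* x) (vieta-sum x d b c) ⟨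
        (x + x′ + w) * x            ≡⟨ solve 3 (λ x x′ w →
          (x :+ x′ :+ w) :* x := x :* x :+ x :* w :+ x :* x′) refl x x′ w ⟩
        x * x + x * w + x * x′      ∎)

    module _ (a₁ a₂ a₃ s x₁ x₂ x₃ : 𝔽 p) where

      lhs₁ : x₁ * x₁ + x₂ * x₂ + x₃ * x₃ + a₁ * x₂ * x₃ + a₂ * x₁ * x₃ + a₃ * x₁ * x₂
             ≡ x₁ * x₁ + x₁ * (a₂ * x₃ + a₃ * x₂) + (x₃ * x₃ + x₂ * x₂ + a₁ * x₃ * x₂)
      lhs₁ = solve 6 (λ a b c x y z →
        x :* x :+ y :* y :+ z :* z :+ a :* y :* z :+ b :* x :* z :+ c :* x :* y
        := x :* x :+ x :* (b :* z :+ c :* y) :+ (z :* z :+ y :* y :+ a :* z :* y))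
        refl a₁ a₂ a₃ x₁ x₂ x₃

      lhs₂ : x₁ * x₁ + x₂ * x₂ + x₃ * x₃ + a₁ * x₂ * x₃ + a₂ * x₁ * x₃ + a₃ * x₁ * x₂
             ≡ x₂ * x₂ + x₂ * (a₃ * x₁ + a₁ * x₃) + (x₁ * x₁ + x₃ * x₃ + a₂ * x₁ * x₃)
      lhs₂ = solve 6 (λ a b c x y z →
        x :* x :+ y :* y :+ z :* z :+ a :* y :* z :+ b :* x :* z :+ c :* x :* y
        := y :* y :+ y :* (c :* x :+ a :* z) :+ (x :* x :+ z :* z :+ b :* x :* z))
        refl a₁ a₂ a₃ x₁ x₂ x₃

      lhs₃ : x₁ * x₁ + x₂ * x₂ + x₃ * x₃ + a₁ * x₂ * x₃ + a₂ * x₁ * x₃ + a₃ * x₁ * x₂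
             ≡ x₃ * x₃ + x₃ * (a₁ * x₂ + a₂ * x₁) + (x₂ * x₂ + x₁ * x₁ + a₃ * x₂ * x₁)
      lhs₃ = solve 6 (λ a b c x y z →
        x :* x :+ y :* y :+ z :* z :+ a :* y :* z :+ b :* x :* z :+ c :* x :* y
        := z :* z :+ z :* (a :* y :+ b :* x) :+ (y :* y :+ x :* x :+ c :* y :* x))
        refl a₁ a₂ a₃ x₁ x₂ x₃

      rhs₁ : s * x₁ * x₂ * x₃ ≡ s * x₃ * x₂ * x₁
      rhs₁ = solve 4 (λ s x y z → s :* x :* y :* z := s :* z :* y :* x) refl s x₁ x₂ x₃

      rhs₂ : s * x₁ * x₂ * x₃ ≡ s * x₁ * x₃ * x₂
      rhs₂ = solve 4 (λ s x y z → s :* x :* y :* z := s :* x :* z :* y) refl s x₁ x₂ x₃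

      rhs₃ : s * x₁ * x₂ * x₃ ≡ s * x₂ * x₁ * x₃
      rhs₃ = solve 4 (λ s x y z → s :* x :* y :* z := s :* y :* x :* z) refl s x₁ x₂ x₃

  moveTriple-solves : ∀ a j {x} → Solves a x → Solves a (moveTriple a j x)
  moveTriple-solves a@(a₁ ∷ a₂ ∷ a₃ ∷ []) 0F {x@(x₁ ∷ x₂ ∷ x₃ ∷ [])} eq =
    trans (lhs₁ a₁ a₂ a₃ s _ x₂ x₃) (trans
      (vieta-root x₁ (s * x₃ * x₂) (a₂ * x₃) (a₃ * x₂) _
        (trans (sym (lhs₁ a₁ a₂ a₃ s x₁ x₂ x₃)) (trans eq (rhs₁ a₁ a₂ a₃ s x₁ x₂ x₃))))
      (sym (rhs₁ a₁ a₂ a₃ s _ x₂ x₃)))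
    where s = coeff-s a
  moveTriple-solves a@(a₁ ∷ a₂ ∷ a₃ ∷ []) 1F {x@(x₁ ∷ x₂ ∷ x₃ ∷ [])} eq =
    trans (lhs₂ a₁ a₂ a₃ s x₁ _ x₃) (trans
      (vieta-root x₂ (s * x₁ * x₃) (a₃ * x₁) (a₁ * x₃) _
        (trans (sym (lhs₂ a₁ a₂ a₃ s x₁ x₂ x₃)) (trans eq (rhs₂ a₁ a₂ a₃ s x₁ x₂ x₃))))
      (sym (rhs₂ a₁ a₂ a₃ s x₁ _ x₃)))
    where s = coeff-s a
  moveTriple-solves a@(a₁ ∷ a₂ ∷ a₃ ∷ []) 2F {x@(x₁ ∷ x₂ ∷ x₃ ∷ [])} eq =
    trans (lhs₃ a₁ a₂ a₃ s x₁ x₂ _) (trans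
      (vieta-root x₃ (s * x₂ * x₁) (a₁ * x₂) (a₂ * x₁) _
        (trans (sym (lhs₃ a₁ a₂ a₃ s x₁ x₂ x₃)) (trans eq (rhs₃ a₁ a₂ a₃ s x₁ x₂ x₃))))
      (sym (rhs₃ a₁ a₂ a₃ s x₁ x₂ _)))
    where s = coeff-s a

  moveTriple-involutive : ∀ a j x → moveTriple a j (moveTriple a j x) ≡ x
  moveTriple-involutive (a₁ ∷ a₂ ∷ a₃ ∷ []) 0F (x₁ ∷ x₂ ∷ x₃ ∷ []) =
    cong (_∷ x₂ ∷ x₃ ∷ []) (vieta-involutive x₁ _ (a₂ * x₃) (a₃ * x₂))
  moveTriple-involutive (a₁ ∷ a₂ ∷ a₃ ∷ []) 1F (x₁ ∷ x₂ ∷ x₃ ∷ []) =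
    cong (λ y → x₁ ∷ y ∷ x₃ ∷ []) (vieta-involutive x₂ _ (a₃ * x₁) (a₁ * x₃))
  moveTriple-involutive (a₁ ∷ a₂ ∷ a₃ ∷ []) 2F (x₁ ∷ x₂ ∷ x₃ ∷ []) =
    cong (λ y → x₁ ∷ x₂ ∷ y ∷ []) (vieta-involutive x₃ _ (a₁ * x₂) (a₂ * x₁))

  module _ (a : Triple p) where

    -- Membership is held irrelevantly, so points of S are propositionally
    -- equal as soon as their coordinates are.
    S : Set
    S = Refinement (Triple p) (Solves a)

    S-≡ : {P Q : S} → value P ≡ value Q → P ≡ Q
    S-≡ refl = refl

    m : Fin 3 → S → S
    m j (x , x∈S) = moveTriple a j x , map (moveTriple-solves a j) x∈S

    m-involutive : ∀ j P → m j (m j P) ≡ P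
    m-involutive j P = S-≡ (moveTriple-involutive a j (value P))

    m↔ : Fin 3 → S ↔ S
    m↔ j = mk↔ₛ′ (m j) (m j) (m-involutive j) (m-involutive j)

    -- The subgroup of the permutations of S generated by m₁, m₂, m₃.
    data ⟨m⟩ : S ↔ S → Set where
      generator : ∀ j → ⟨m⟩ (m↔ j)
      identity  : ⟨m⟩ (↔-id S)
      compose   : ∀ {g h} → ⟨m⟩ g → ⟨m⟩ h → ⟨m⟩ (g ↔-∘ h)
      inverse   : ∀ {g} → ⟨m⟩ g → ⟨m⟩ (↔-sym g)

    Orbit : S → Pred S 0ℓ
    Orbit P Q = ∃[ g ] ⟨m⟩ g × Inverse.to g P ≡ Q

    S∖0 : Pred S 0ℓ
    S∖0 P = value P ≢ replicate 3 ⌜ 0 ⌝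

    UnionOfAtLeastOrbits : ℕ → Pred S 0ℓ → Set
    UnionOfAtLeastOrbits k U =
      ∃[ n ] k ℕ.≤ n × Σ[ r ∈ (Fin n → S) ]
        (∀ {i j : Fin n} → i ≢ j → ¬ (Orbit (r i) ≐ Orbit (r j)))
        × U ≐ ⋃ (Fin n) (Orbit ∘ r)

module Submission where

-- With u = x_{i+1} + σ x_{i-1} the equation reads x_i² + α x_i u + u² = s x₁ x₂ x₃,
-- so m_i replaces x_i by x_i′ with x_i x_i′ = u², and the other moves fix x_i:
-- the square class of x_i is constant on orbits.  A vanishing x_i forces u = 0
-- and x_i′ = -σ s x_{i-1}², so 0 is given the class of -σ s.  Both classes occur
-- when p > 3.  If α = ±2, this applies at every index, and the classes at two
-- indices separate four orbits.  Orbits are the connected components of a finite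
-- graph, so membership is decidable and representatives can be listed.

open import Defs
open import Algebra.Bundles using (CommutativeRing)
open import Algebra.Solver.Ring.AlmostCommutativeRing 
  using (fromCommutativeRing; _-Raw-AlmostCommutative⟶_; Induced-equivalence)
open import Data.Bool using (Bool; true; false)
open import Data.Fin as Fin using (Fin; toℕ)
open import Data.Fin.Patterns using (0F; 1F; 2F)
open import Data.Fin.Properties as Fin
  using (any?; injective⇒≤; punchOut-injective; toℕ<n; toℕ-fromℕ<; fromℕ<-cong; fromℕ<-toℕ; ¬∀⟶∃¬; <⇒notInjective)
open import Data.Integer as ℤ using (ℤ; -[1+_]; +0; +[1+_]; _⊖_)
import Data.Integer.Properties as ℤ
open import Data.Irrelevant using ([_])
open import Data.List as List using (List; []; _∷_; allFin; cartesianProductWith; concatMap; deduplicate; filter; length)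
open import Data.List.Membership.Propositional using (_∈_)
open import Data.List.Membership.Propositional.Properties
  using (∈-allFin; ∈-lookup; ∈-concatMap⁺; ∈-cartesianProductWith⁺; ∈-cartesianProductWith⁻;
         ∈-deduplicate⁻; ∈-filter⁺; ∈-filter⁻; ∈-map⁺)
open import Data.List.Relation.Unary.All as All using (All)
open import Data.List.Relation.Unary.AllPairs using (AllPairs; _∷_)
open import Data.List.Relation.Unary.Any as Any using (Any; here; there)
import Data.List.Relation.Unary.Any.Properties as Any
import Data.List.Relation.Unary.Unique.DecSetoid.Properties as UniqueDec
import Data.Maybe as Maybe
open import Data.Nat as ℕ using (ℕ; zero; suc; NonZero)
open import Data.Nat.DivMod using (_%_; m%n<n; m<n⇒m%n≡m; %-distribˡ-+; %-distribˡ-*)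
open import Data.Nat.Divisibility as ℕ using (_∣_; _∤_; ∣-reflexive)
open import Data.Nat.Induction using (<-rec)
open import Data.Nat.Primality using (Prime; euclidsLemma; prime?; prime⇒irreducible; prime⇒nonTrivial)
import Data.Nat.Properties as ℕ
open import Data.Product using (∃-syntax; _×_; _,_; proj₁; proj₂)
open import Data.Product.Function.NonDependent.Propositional using (_×-↔_)
open import Data.Refinement using (_,_; value)
open import Data.Sum as Sum using (_⊎_; inj₁; inj₂; [_,_]′)
open import Data.Vec using (Vec; []; _∷_; lookup; replicate; _[_]≔_)
import Data.Vec.Properties as Vec
open import Function using (_∘_; _↔_; id; Injection; Injective; Inverse; mk⇔)
open import Function.Construct.Composition using (_↔-∘_)
open import Function.Construct.Identity using (↔-id)
open import Function.Construct.Symmetry using (↔-sym)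
open import Function.Properties.Inverse using (↔⇒↣)
open import Level using (0ℓ)
open import Relation.Binary using (DecSetoid; IsEquivalence; Reflexive; Rel; Symmetric; Transitive)
  renaming (Decidable to Decidable₂)
open import Relation.Binary.Definitions using (WeaklyDecidable)
open import Relation.Binary.Consequences using (dec⇒weaklyDec)
open import Relation.Binary.PropositionalEquality
  using (_≡_; _≢_; refl; sym; trans; cong; cong₂; subst; module ≡-Reasoning)
open import Relation.Nullary using (¬_; Dec; yes; no; does; contradiction; recompute)
open import Relation.Nullary.Decidable as Dec
  using (_×-dec_; _⊎-dec_; ¬?; decidable-stable; dec-true; dec-false; does-⇔; from-yes)
open import Relation.Unary using (Decidable; Pred)

import Algebra.Properties.Ring as RingProperties
import Algebra.Solver.Ring as RingSolver

-- Arithmetic modulo p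

-- Points with x_i = 0 always exist and have the class of -σ s, so the work lies in producing a
-- point of the other class. Fixing x_i = t leaves a conic in the other two coordinates. Its
-- discriminant has, up to squares, leading coefficient 1 + y, where y = -4 / (σ s t) has the class
-- of -σ s t. A point can be written down as soon as 1 + y is a nonzero square r², so a nonsquare of
-- the form r² - 1 with r ≠ 0 is needed. Modulo 3 every such r² - 1 vanishes, and the claim itself
-- fails there: for a = (2, 0, 0) the six nonzero solutions form a single orbit. This is why p = 3
-- is excluded. For α = ±2 no such conic is needed: points with one vanishing coordinate realise
-- three of the four pairs of classes, and the fourth as well when -1 is a square. When it is not,
-- the multiple of (±1, ±1, ±1) lying on the surface supplies the fourth.

module Residues (p : ℕ) .{{_ : NonZero p}} where

  open CommutativeRing (𝔽-commutativeRing p) public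
    using (+-assoc; +-comm; +-identityˡ; +-identityʳ; *-comm; *-assoc; *-identityˡ; *-identityʳ;
           -‿inverseʳ; -‿inverseˡ; zeroˡ; zeroʳ)
  open RingProperties (CommutativeRing.ring (𝔽-commutativeRing p)) public
    using (-‿+-comm; -‿involutive; -‿distribˡ-*; -‿distribʳ-*; -0#≈0#)

  toℕ-⌜⌝ : ∀ n → toℕ {p} ⌜ n ⌝ ≡ n % p
  toℕ-⌜⌝ n = toℕ-fromℕ< (m%n<n n p)

  ⌜⌝-cong : ∀ {m n} → m % p ≡ n % p → ⌜ m ⌝ ≡ ⌜ n ⌝
  ⌜⌝-cong {m} {n} eq = fromℕ<-cong (m % p) (n % p) eq (m%n<n m p) (m%n<n n p)

  ⌜toℕ⌝ : ∀ (x : 𝔽 p) → ⌜ toℕ x ⌝ ≡ x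
  ⌜toℕ⌝ x = trans
    (fromℕ<-cong _ _ (m<n⇒m%n≡m (toℕ<n x)) (m%n<n (toℕ x) p) (toℕ<n x))
    (fromℕ<-toℕ x (toℕ<n x))

  ⌜⌝-+ : ∀ m n → ⌜ m ℕ.+ n ⌝ ≡ ⌜ m ⌝ + ⌜ n ⌝
  ⌜⌝-+ m n = trans (⌜⌝-cong (%-distribˡ-+ m n p))
    (cong₂ (λ a b → ⌜ a ℕ.+ b ⌝) (sym (toℕ-⌜⌝ m)) (sym (toℕ-⌜⌝ n)))

  ⌜⌝-* : ∀ m n → ⌜ m ℕ.* n ⌝ ≡ ⌜ m ⌝ * ⌜ n ⌝
  ⌜⌝-* m n = trans (⌜⌝-cong (%-distribˡ-* m n p))
    (cong₂ (λ a b → ⌜ a ℕ.* b ⌝) (sym (toℕ-⌜⌝ m)) (sym (toℕ-⌜⌝ n)))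

  -- Coefficient map for the ring solver. Numerals modulo a variable `p` do not compute, whereas
  -- integer coefficients do, so identities such as 2 * 2 = 4 or x - x = 0 are settled in ℤ and
  -- transported.
  ⌞_⌟ : ℤ → 𝔽 p
  ⌞ ℤ.+ n ⌟    = ⌜ n ⌝
  ⌞ -[1+ n ] ⌟ = - ⌜ suc n ⌝

  ⌞⊖⌟ : ∀ m n → ⌞ m ⊖ n ⌟ ≡ ⌜ m ⌝ - ⌜ n ⌝
  ⌞⊖⌟ m       zero    = sym (trans (cong (λ z → ⌜ m ⌝ + z) -0#≈0#) (+-identityʳ _))
  ⌞⊖⌟ zero    (suc n) = sym (+-identityˡ _)
  ⌞⊖⌟ (suc m) (suc n) = begin
    ⌞ suc m ⊖ suc n ⌟                          ≡⟨ cong ⌞_⌟ (ℤ.[1+m]⊖[1+n]≡m⊖n m n) ⟩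
    ⌞ m ⊖ n ⌟                                  ≡⟨ ⌞⊖⌟ m n ⟩
    ⌜ m ⌝ - ⌜ n ⌝                              ≡⟨ cong (_- ⌜ n ⌝) (+-identityˡ _) ⟨
    ⌜ 0 ⌝ + ⌜ m ⌝ - ⌜ n ⌝                      ≡⟨ cong (λ z → z + ⌜ m ⌝ - ⌜ n ⌝) (-‿inverseʳ ⌜ 1 ⌝) ⟨
    ⌜ 1 ⌝ - ⌜ 1 ⌝ + ⌜ m ⌝ - ⌜ n ⌝              ≡⟨ cong (_- ⌜ n ⌝) (trans (+-assoc ⌜ 1 ⌝ (- ⌜ 1 ⌝) ⌜ m ⌝)
      (trans (cong (λ z → ⌜ 1 ⌝ + z) (+-comm (- ⌜ 1 ⌝) ⌜ m ⌝)) (sym (+-assoc ⌜ 1 ⌝ ⌜ m ⌝ (- ⌜ 1 ⌝))))) ⟩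
    ⌜ 1 ⌝ + ⌜ m ⌝ - ⌜ 1 ⌝ - ⌜ n ⌝              ≡⟨ +-assoc (⌜ 1 ⌝ + ⌜ m ⌝) (- ⌜ 1 ⌝) (- ⌜ n ⌝) ⟩
    ⌜ 1 ⌝ + ⌜ m ⌝ + (- ⌜ 1 ⌝ - ⌜ n ⌝)          ≡⟨ cong₂ _+_ (sym (⌜⌝-+ 1 m))
      (trans (-‿+-comm ⌜ 1 ⌝ ⌜ n ⌝) (cong (λ z → - z) (sym (⌜⌝-+ 1 n)))) ⟩
    ⌜ suc m ⌝ - ⌜ suc n ⌝                      ∎
    where open ≡-Reasoning

  ⌞⌟-+ : ∀ i j → ⌞ i ℤ.+ j ⌟ ≡ ⌞ i ⌟ + ⌞ j ⌟
  ⌞⌟-+ (ℤ.+ m)    (ℤ.+ n)    = ⌜⌝-+ m n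
  ⌞⌟-+ (ℤ.+ m)    (-[1+ n ]) = ⌞⊖⌟ m (suc n)
  ⌞⌟-+ (-[1+ m ]) (ℤ.+ n)    = trans (⌞⊖⌟ n (suc m)) (+-comm ⌜ n ⌝ (- ⌜ suc m ⌝))
  ⌞⌟-+ (-[1+ m ]) (-[1+ n ]) = begin
    - ⌜ suc (suc (m ℕ.+ n)) ⌝    ≡⟨ cong (λ k → - ⌜ suc k ⌝) (ℕ.+-suc m n) ⟨
    - ⌜ suc m ℕ.+ suc n ⌝        ≡⟨ cong (λ z → - z) (⌜⌝-+ (suc m) (suc n)) ⟩
    - (⌜ suc m ⌝ + ⌜ suc n ⌝)    ≡⟨ -‿+-comm ⌜ suc m ⌝ ⌜ suc n ⌝ ⟨
    - ⌜ suc m ⌝ - ⌜ suc n ⌝      ∎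
    where open ≡-Reasoning

  ⌞⌟-neg : ∀ i → ⌞ ℤ.- i ⌟ ≡ - ⌞ i ⌟
  ⌞⌟-neg +0         = sym -0#≈0#
  ⌞⌟-neg +[1+ n ]   = refl
  ⌞⌟-neg (-[1+ n ]) = sym (-‿involutive _)

  ⌞+⌟-* : ∀ m j → ⌞ ℤ.+ m ℤ.* j ⌟ ≡ ⌜ m ⌝ * ⌞ j ⌟
  ⌞+⌟-* m (ℤ.+ n)    = trans (cong ⌞_⌟ (sym (ℤ.pos-* m n))) (⌜⌝-* m n)
  ⌞+⌟-* m (-[1+ n ]) = begin
    ⌞ ℤ.+ m ℤ.* ℤ.- ℤ.+ suc n ⌟      ≡⟨ cong ⌞_⌟ (ℤ.neg-distribʳ-* (ℤ.+ m) (ℤ.+ suc n)) ⟨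
    ⌞ ℤ.- (ℤ.+ m ℤ.* ℤ.+ suc n) ⌟    ≡⟨ ⌞⌟-neg (ℤ.+ m ℤ.* ℤ.+ suc n) ⟩
    - ⌞ ℤ.+ m ℤ.* ℤ.+ suc n ⌟        ≡⟨ cong (λ z → - z) (⌞+⌟-* m (ℤ.+ suc n)) ⟩
    - (⌜ m ⌝ * ⌜ suc n ⌝)            ≡⟨ -‿distribʳ-* ⌜ m ⌝ ⌜ suc n ⌝ ⟩
    ⌜ m ⌝ * - ⌜ suc n ⌝              ∎
    where open ≡-Reasoning

  ⌞⌟-* : ∀ i j → ⌞ i ℤ.* j ⌟ ≡ ⌞ i ⌟ * ⌞ j ⌟
  ⌞⌟-* (ℤ.+ m)    j = ⌞+⌟-* m j
  ⌞⌟-* (-[1+ m ]) j = begin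
    ⌞ ℤ.- ℤ.+ suc m ℤ.* j ⌟        ≡⟨ cong ⌞_⌟ (ℤ.neg-distribˡ-* (ℤ.+ suc m) j) ⟨
    ⌞ ℤ.- (ℤ.+ suc m ℤ.* j) ⌟      ≡⟨ ⌞⌟-neg (ℤ.+ suc m ℤ.* j) ⟩
    - ⌞ ℤ.+ suc m ℤ.* j ⌟          ≡⟨ cong (λ z → - z) (⌞+⌟-* (suc m) j) ⟩
    - (⌜ suc m ⌝ * ⌞ j ⌟)          ≡⟨ -‿distribˡ-* ⌜ suc m ⌝ ⌞ j ⌟ ⟩
    - ⌜ suc m ⌝ * ⌞ j ⌟            ∎
    where open ≡-Reasoning

  ⌞⌟-morphism : ℤ.+-*-rawRing -Raw-AlmostCommutative⟶ fromCommutativeRing (𝔽-commutativeRing p)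
  ⌞⌟-morphism = record
    { ⟦_⟧ = ⌞_⌟ ; +-homo = ⌞⌟-+ ; *-homo = ⌞⌟-* ; -‿homo = ⌞⌟-neg ; 0-homo = refl ; 1-homo = refl }

  ⌞⌟-≟ : WeaklyDecidable (Induced-equivalence ⌞⌟-morphism)
  ⌞⌟-≟ i j = Maybe.map (cong ⌞_⌟) (dec⇒weaklyDec ℤ._≟_ i j)

  open RingSolver ℤ.+-*-rawRing (fromCommutativeRing (𝔽-commutativeRing p)) ⌞⌟-morphism ⌞⌟-≟ public
    using (Polynomial; solve; con; _:+_; _:*_; _:-_; :-_; _:=_)

  lit : ∀ {n} → ℕ → Polynomial n
  lit k = con (ℤ.+ k)

-- Pigeonhole: if `y` were missed, punching it out of the codomain would inject a finite set into a
-- smaller one.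
injective⇒surjective : ∀ {n} {f : Fin n → Fin n} → Injective _≡_ _≡_ f → ∀ y → ∃[ x ] f x ≡ y
injective⇒surjective {suc n} {f} f-inj y with any? (λ x → f x Fin.≟ y)
... | yes hit = hit
... | no miss = contradiction
  (λ {i} {j} eq → f-inj (punchOut-injective (miss ∘ (i ,_) ∘ sym) (miss ∘ (j ,_) ∘ sym) eq))
  (<⇒notInjective (ℕ.n<1+n n))

even⊎odd : ∀ n → ∃[ m ] (n ≡ 2 ℕ.* m ⊎ n ≡ suc (2 ℕ.* m))
even⊎odd zero = 0 , inj₁ refl
even⊎odd (suc n) with even⊎odd n
... | m , inj₁ refl = m , inj₂ refl
... | m , inj₂ refl = suc m , inj₁ (sym (ℕ.*-suc 2 m))

-- Inverses and squares in a prime field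

module PrimeField (p : ℕ) .{{_ : NonZero p}} (p-prime : Prime p) where

  open Residues p public

  ⌜⌝≡0⇒∣ : ∀ {n} → ⌜ n ⌝ ≡ ⌜ 0 ⌝ → p ∣ n
  ⌜⌝≡0⇒∣ {n} eq = ℕ.m%n≡0⇒n∣m n p (trans (sym (toℕ-⌜⌝ n)) (trans (cong toℕ eq)
    (trans (toℕ-⌜⌝ 0) (m<n⇒m%n≡m (ℕ.>-nonZero⁻¹ p)))))

  ∣⇒⌜⌝≡0 : ∀ {n} → p ∣ n → ⌜ n ⌝ ≡ ⌜ 0 ⌝
  ∣⇒⌜⌝≡0 {n} p∣n = ⌜⌝-cong (trans (ℕ.n∣m⇒m%n≡0 n p p∣n) (sym (m<n⇒m%n≡m (ℕ.>-nonZero⁻¹ p))))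

  ⌜⌝≢0 : ∀ {n} .{{_ : NonZero n}} → n ℕ.< p → ⌜ n ⌝ ≢ ⌜_⌝ {p} 0
  ⌜⌝≢0 n<p eq = ℕ.<⇒≱ n<p (ℕ.∣⇒≤ (⌜⌝≡0⇒∣ eq))

  1≢0 : ⌜ 1 ⌝ ≢ ⌜ 0 ⌝
  1≢0 = ⌜⌝≢0 (ℕ.nonTrivial⇒n>1 p {{prime⇒nonTrivial p-prime}})

  x*y≡0 : ∀ {x y} → x * y ≡ ⌜ 0 ⌝ → x ≡ ⌜ 0 ⌝ ⊎ y ≡ ⌜ 0 ⌝
  x*y≡0 {x} {y} eq = Sum.map zero′ zero′ (euclidsLemma (toℕ x) (toℕ y) p-prime (⌜⌝≡0⇒∣ eq))
    where
    zero′ : ∀ {z : 𝔽 p} → p ∣ toℕ z → z ≡ ⌜ 0 ⌝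
    zero′ {z} p∣z = trans (sym (⌜toℕ⌝ z)) (∣⇒⌜⌝≡0 p∣z)

  *-≢0 : ∀ {x y} → x ≢ ⌜ 0 ⌝ → y ≢ ⌜ 0 ⌝ → x * y ≢ ⌜ 0 ⌝
  *-≢0 x≢0 y≢0 = [ x≢0 , y≢0 ]′ ∘ x*y≡0

  x*x≡0 : ∀ {x} → x * x ≡ ⌜ 0 ⌝ → x ≡ ⌜ 0 ⌝
  x*x≡0 eq = [ id , id ]′ (x*y≡0 eq)

  x-y≡0⇒x≡y : ∀ {x y} → x - y ≡ ⌜ 0 ⌝ → x ≡ y
  x-y≡0⇒x≡y {x} {y} eq = begin
    x            ≡⟨ solve 2 (λ x y → x := (x :- y) :+ y) refl x y ⟩
    x - y + y    ≡⟨ cong (_+ y) eq ⟩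
    ⌜ 0 ⌝ + y    ≡⟨ +-identityˡ y ⟩
    y            ∎
    where open ≡-Reasoning

  x≡y⇒x-y≡0 : ∀ {x y} → x ≡ y → x - y ≡ ⌜ 0 ⌝
  x≡y⇒x-y≡0 {x} refl = -‿inverseʳ x

  -x≢0 : ∀ {x} → x ≢ ⌜ 0 ⌝ → - x ≢ ⌜ 0 ⌝
  -x≢0 x≢0 eq = x≢0 (trans (sym (-‿involutive _)) (trans (cong (λ z → - z) eq) -0#≈0#))

  *-cancelˡ : ∀ {x y z} → x ≢ ⌜ 0 ⌝ → x * y ≡ x * z → y ≡ z
  *-cancelˡ {x} {y} {z} x≢0 eq =
    [ (λ x≡0 → contradiction x≡0 x≢0) , x-y≡0⇒x≡y {y} {z} ]′ (x*y≡0 {x} {y - z} (trans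
      (solve 3 (λ x y z → x :* (y :- z) := x :* y :- x :* z) refl x y z)
      (x≡y⇒x-y≡0 {x * y} {x * z} eq)))

  -- Multiplication by a nonzero element is injective on a finite set, hence hits 1.
  inverse-of : ∀ {x} → x ≢ ⌜ 0 ⌝ → ∃[ y ] x * y ≡ ⌜ 1 ⌝
  inverse-of {x} x≢0 = injective⇒surjective {f = λ y → x * y} (*-cancelˡ x≢0) ⌜ 1 ⌝

  Square : 𝔽 p → Set
  Square x = ∃[ r ] r * r ≡ x

  square? : ∀ x → Dec (Square x)
  square? x = any? (λ r → r * r Fin.≟ x)

  ¬square⇒≢0 : ∀ {x} → ¬ Square x → x ≢ ⌜ 0 ⌝
  ¬square⇒≢0 ns x≡0 = ns (⌜ 0 ⌝ , trans (zeroˡ ⌜ 0 ⌝) (sym x≡0))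

  square-* : ∀ {x y} → Square x → Square y → Square (x * y)
  square-* (q , refl) (r , refl) =
    q * r , solve 2 (λ q r → (q :* r) :* (q :* r) := (q :* q) :* (r :* r)) refl q r

  square-cancelˡ : ∀ {x y} → x ≢ ⌜ 0 ⌝ → Square x → Square (x * y) → Square y
  square-cancelˡ {y = y} x≢0 (q , refl) (r , r²≡q²y) =
    let (i , qi≡1) = inverse-of {q} (λ q≡0 → x≢0 (trans (cong (_* q) q≡0) (zeroˡ q))) in
    r * i , (begin
      r * i * (r * i)          ≡⟨ solve 2 (λ r i → (r :* i) :* (r :* i) := (r :* r) :* (i :* i)) refl r i ⟩
      r * r * (i * i)          ≡⟨ cong (_* (i * i)) r²≡q²y ⟩
      q * q * y * (i * i)      ≡⟨ solve 3 (λ q y i → ((q :* q) :* y) :* (i :* i) := ((q :* i) :* (q :* i)) :* y) refl q y i ⟩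
      q * i * (q * i) * y      ≡⟨ cong (λ z → z * z * y) qi≡1 ⟩
      ⌜ 1 ⌝ * ⌜ 1 ⌝ * y        ≡⟨ solve 1 (λ y → (lit 1 :* lit 1) :* y := y) refl y ⟩
      y                        ∎)
    where open ≡-Reasoning

  square-⌜⌝* : ∀ m n → Square ⌜ m ⌝ → Square ⌜ n ⌝ → Square ⌜ m ℕ.* n ⌝
  square-⌜⌝* m n sm sn = subst Square (sym (⌜⌝-* m n)) (square-* sm sn)

  module _ (2≢0 : ⌜ 2 ⌝ ≢ ⌜_⌝ {p} 0) where

    -- A choice of square roots is an injection of 𝔽 p into itself, hence onto,
    -- although 1 and -1 cannot both be the chosen root of 1.
    not-all-square : ¬ (∀ x → Square x)
    not-all-square all-square = 1≢-1 (trans (sym (√²≡ ⌜ 1 ⌝ 1²)) (√²≡ (- ⌜ 1 ⌝) -1²))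
      where
      √ : 𝔽 p → 𝔽 p
      √ x = proj₁ (all-square x)
      √-injective : Injective _≡_ _≡_ √
      √-injective {x} {y} eq = trans (sym (proj₂ (all-square x)))
        (trans (cong (λ r → r * r) eq) (proj₂ (all-square y)))
      √²≡ : ∀ y → y * y ≡ ⌜ 1 ⌝ → √ ⌜ 1 ⌝ ≡ y
      √²≡ y y²≡1 =
        let (x , √x≡y) = injective⇒surjective √-injective y in
        trans (cong √ (trans (sym y²≡1) (trans (cong (λ r → r * r) (sym √x≡y)) (proj₂ (all-square x))))) √x≡y
      1² : ⌜ 1 ⌝ * ⌜ 1 ⌝ ≡ ⌜ 1 ⌝
      1² = *-identityˡ ⌜ 1 ⌝
      -1² : - ⌜ 1 ⌝ * - ⌜ 1 ⌝ ≡ ⌜ 1 ⌝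
      -1² = solve 0 (:- lit 1 :* :- lit 1 := lit 1) refl
      1≢-1 : ⌜ 1 ⌝ ≢ - ⌜ 1 ⌝
      1≢-1 eq = 2≢0 (trans (solve 0 (lit 2 := lit 1 :- (:- lit 1)) refl) (x≡y⇒x-y≡0 eq))

    nonsquare : ∃[ x ] ¬ Square x
    nonsquare = ¬∀⟶∃¬ p Square square? not-all-square

    module _ (3≢0 : ⌜ 3 ⌝ ≢ ⌜_⌝ {p} 0) where

      private
        -- If q - 1 is a square for every nonzero square q, then 4, 3 and 2 are
        -- squares, and an even n is twice a smaller number, an odd n one less
        -- than such a number: every residue is a square.
        module _ (pred-square : ∀ r → r ≢ ⌜ 0 ⌝ → Square (r * r - ⌜ 1 ⌝)) where

          ⌜⌝-pred-square : ∀ n → ⌜ suc n ⌝ ≢ ⌜ 0 ⌝ → Square ⌜ suc n ⌝ → Square ⌜ n ⌝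
          ⌜⌝-pred-square n n+1≢0 (r , r²≡) = subst Square
            (trans (cong (_- ⌜ 1 ⌝) (trans r²≡ (⌜⌝-+ 1 n)))
              (solve 1 (λ x → (lit 1 :+ x) :- lit 1 := x) refl ⌜ n ⌝))
            (pred-square r (λ r≡0 → n+1≢0 (trans (sym r²≡) (trans (cong (_* r) r≡0) (zeroˡ r)))))

          square-2 : Square ⌜ 2 ⌝
          -- Each descent starts from a nonzero square; the one from 3 to 2 is where characteristic
          -- 3 must be excluded.
          square-2 = ⌜⌝-pred-square 2 3≢0 (⌜⌝-pred-square 3
            (λ 4≡0 → *-≢0 2≢0 2≢0 (trans (sym (⌜⌝-* 2 2)) 4≡0)) (⌜ 2 ⌝ , sym (⌜⌝-* 2 2)))

          square-⌜⌝ : ∀ n → n ℕ.< p → Square ⌜ n ⌝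
          square-⌜⌝ = <-rec _ step
            where
            step : ∀ n → (∀ {m} → m ℕ.< n → m ℕ.< p → Square ⌜ m ⌝) → n ℕ.< p → Square ⌜ n ⌝
            step 0 _ _ = ⌜ 0 ⌝ , zeroˡ ⌜ 0 ⌝
            step 1 _ _ = ⌜ 1 ⌝ , *-identityˡ ⌜ 1 ⌝
            step n@(suc (suc _)) rec n<p with even⊎odd n
            ... | m@(suc _) , inj₁ n≡2m = subst (λ k → Square ⌜ k ⌝) (sym n≡2m)
              (square-⌜⌝* 2 m square-2 (rec m<n (ℕ.<-trans m<n n<p)))
              where
              m<n : m ℕ.< n
              m<n = subst (m ℕ.<_) (sym n≡2m) (ℕ.m<m+n m (ℕ.s≤s ℕ.z≤n))
            -- Here n + 1 = 2 (m + 1), and m + 1 < n because m is positive, so the recursion reaches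
            -- m + 1. That n + 1 is nonzero modulo p follows from its two factors.
            ... | m@(suc _) , inj₂ n≡1+2m = ⌜⌝-pred-square n
              (λ n+1≡0 → *-≢0 2≢0 (⌜⌝≢0 m+1<p)
                (trans (sym (⌜⌝-* 2 (suc m))) (trans (cong ⌜_⌝ (sym n+1≡2m+2)) n+1≡0)))
              (subst (λ k → Square ⌜ k ⌝) (sym n+1≡2m+2)
                (square-⌜⌝* 2 (suc m) square-2 (rec m+1<n m+1<p)))
              where
              n+1≡2m+2 : suc n ≡ 2 ℕ.* suc m
              n+1≡2m+2 = trans (cong suc n≡1+2m) (sym (ℕ.*-suc 2 m))
              m+1<n : suc m ℕ.< n
              m+1<n = subst (suc m ℕ.<_) (sym n≡1+2m) (ℕ.s<s (ℕ.m<m+n m (ℕ.s≤s ℕ.z≤n)))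
              m+1<p : suc m ℕ.< p
              m+1<p = ℕ.<-trans m+1<n n<p

      -- Supplies the nonsquare class together with the root `r` of the leading coefficient of a
      -- discriminant. The finite search turns the refutation of the opposite into a witness.
      nonsquare-r²-1 : ∃[ r ] r ≢ ⌜ 0 ⌝ × ¬ Square (r * r - ⌜ 1 ⌝)
      nonsquare-r²-1 with any? (λ r → ¬? (r Fin.≟ ⌜ 0 ⌝) ×-dec ¬? (square? (r * r - ⌜ 1 ⌝)))
      ... | yes found = found
      ... | no  none  = contradiction
        (λ x → subst Square (⌜toℕ⌝ x) (square-⌜⌝ (λ r r≢0 →
          decidable-stable (square? _) (λ ns → none (r , r≢0 , ns))) (toℕ x) (toℕ<n x)))
        not-all-square

-- Orbits as connected components

module _ {A : Set} where

  -- Adding one edge u — v to an equivalence relation only merges the classes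
  -- of u and v, which keeps the relation decidable.
  Connected : List (A × A) → Rel A 0ℓ
  Connected []             x y = x ≡ y
  Connected ((u , v) ∷ es) x y =
    Connected es x y ⊎ (Connected es x u × Connected es v y) ⊎ (Connected es x v × Connected es u y)

  connected? : Decidable₂ {A = A} _≡_ → ∀ es → Decidable₂ (Connected es)
  connected? _≟_ []             x y = x ≟ y
  connected? _≟_ ((u , v) ∷ es) x y =
    connected? _≟_ es x y
      ⊎-dec (connected? _≟_ es x u ×-dec connected? _≟_ es v y)
      ⊎-dec (connected? _≟_ es x v ×-dec connected? _≟_ es u y)

  connected-refl : ∀ es → Reflexive (Connected es)
  connected-refl []       = refl
  connected-refl (_ ∷ es) = inj₁ (connected-refl es)

  connected-sym : ∀ es → Symmetric (Connected es)
  connected-sym []       p                      = sym p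
  connected-sym (_ ∷ es) (inj₁ p)               = inj₁ (connected-sym es p)
  connected-sym (_ ∷ es) (inj₂ (inj₁ (p , q)))  = inj₂ (inj₂ (connected-sym es q , connected-sym es p))
  connected-sym (_ ∷ es) (inj₂ (inj₂ (p , q)))  = inj₂ (inj₁ (connected-sym es q , connected-sym es p))

  connected-trans : ∀ es → Transitive (Connected es)
  connected-trans []       p q = trans p q
  connected-trans (_ ∷ es) (inj₁ p)              (inj₁ q)              = inj₁ (connected-trans es p q)
  connected-trans (_ ∷ es) (inj₁ p)              (inj₂ (inj₁ (q , r))) = inj₂ (inj₁ (connected-trans es p q , r))
  connected-trans (_ ∷ es) (inj₁ p)              (inj₂ (inj₂ (q , r))) = inj₂ (inj₂ (connected-trans es p q , r))
  connected-trans (_ ∷ es) (inj₂ (inj₁ (p , q))) (inj₁ r)              = inj₂ (inj₁ (p , connected-trans es q r))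
  connected-trans (_ ∷ es) (inj₂ (inj₂ (p , q))) (inj₁ r)              = inj₂ (inj₂ (p , connected-trans es q r))
  connected-trans (_ ∷ es) (inj₂ (inj₁ (p , q))) (inj₂ (inj₁ (r , t))) = inj₂ (inj₁ (p , t))
  connected-trans (_ ∷ es) (inj₂ (inj₂ (p , q))) (inj₂ (inj₂ (r , t))) = inj₂ (inj₂ (p , t))
  connected-trans (_ ∷ es) (inj₂ (inj₁ (p , q))) (inj₂ (inj₂ (r , t))) = inj₁ (connected-trans es p t)
  connected-trans (_ ∷ es) (inj₂ (inj₂ (p , q))) (inj₂ (inj₁ (r , t))) = inj₁ (connected-trans es p t)

  ∈⇒connected : ∀ {es x y} → (x , y) ∈ es → Connected es x y
  ∈⇒connected {_ ∷ es} (here refl) = inj₂ (inj₁ (connected-refl es , connected-refl es))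
  ∈⇒connected (there e∈es)         = inj₁ (∈⇒connected e∈es)

  connected-minimal : ∀ {R : Rel A 0ℓ} → IsEquivalence R → ∀ es →
                      (∀ {x y} → (x , y) ∈ es → R x y) → ∀ {x y} → Connected es x y → R x y
  connected-minimal {R} isEq = go
    where
    open IsEquivalence isEq renaming (refl to R-refl; sym to R-sym; trans to R-trans)
    go : ∀ es → (∀ {x y} → (x , y) ∈ es → R x y) → ∀ {x y} → Connected es x y → R x y
    go []       _    refl                  = R-refl
    go (_ ∷ es) es⊆R (inj₁ p)              = go es (es⊆R ∘ there) p
    go (_ ∷ es) es⊆R (inj₂ (inj₁ (p , q))) =
      R-trans (go es (es⊆R ∘ there) p) (R-trans (es⊆R (here refl)) (go es (es⊆R ∘ there) q))
    go (_ ∷ es) es⊆R (inj₂ (inj₂ (p , q))) =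
      R-trans (go es (es⊆R ∘ there) p) (R-trans (R-sym (es⊆R (here refl))) (go es (es⊆R ∘ there) q))

AllPairs-lookup : ∀ {A : Set} {R : Rel A 0ℓ} → Symmetric R → ∀ {xs} → AllPairs R xs →
                  ∀ {i j} → i ≢ j → R (List.lookup xs i) (List.lookup xs j)
AllPairs-lookup R-sym (_  ∷ _)   {Fin.zero}  {Fin.zero}  i≢j = contradiction refl i≢j
AllPairs-lookup R-sym (px ∷ _)   {Fin.zero}  {Fin.suc j} _   = All.lookup px (∈-lookup j)
AllPairs-lookup R-sym (px ∷ _)   {Fin.suc i} {Fin.zero}  _   = R-sym (All.lookup px (∈-lookup i))
AllPairs-lookup R-sym (_  ∷ pxs) {Fin.suc i} {Fin.suc j} i≢j =
  AllPairs-lookup R-sym pxs (i≢j ∘ cong Fin.suc)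

-- Listing the points of S and deciding orbits

module _ {p : ℕ} .{{_ : NonZero p}} where

  solves? : ∀ (a x : Triple p) → Dec (Solves a x)
  solves? (_ ∷ _ ∷ _ ∷ []) (_ ∷ _ ∷ _ ∷ []) = _ Fin.≟ _

  module _ (a : Triple p) where

    _≟ₛ_ : Decidable₂ {A = S a} _≡_
    P ≟ₛ Q = Dec.map′ (S-≡ a) (cong value) (Vec.≡-dec Fin._≟_ (value P) (value Q))

    fromTriple : Triple p → List (S a)
    fromTriple x with solves? a x
    ... | yes x∈S = List.[ (x , [ x∈S ]) ]
    ... | no  _   = []

    triples : List (Triple p)
    triples = cartesianProductWith _∷_ (allFin p) (cartesianProductWith _∷_ (allFin p)
      (List.map (_∷ []) (allFin p)))

    ∈-triples : ∀ x → x ∈ triples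
    ∈-triples (x₁ ∷ x₂ ∷ x₃ ∷ []) =
      ∈-cartesianProductWith⁺ _∷_ (∈-allFin x₁)
        (∈-cartesianProductWith⁺ _∷_ (∈-allFin x₂) (∈-map⁺ _ (∈-allFin x₃)))

    ∈-fromTriple : ∀ P → P ∈ fromTriple (value P)
    ∈-fromTriple (x , [ x∈S ]) with solves? a x
    ... | yes _   = here refl
    -- Membership in S is irrelevant, so it can refute `x∉S` only after being recomputed from the
    -- decision procedure.
    ... | no  x∉S = contradiction (recompute (solves? a x) x∈S) x∉S

    points : List (S a)
    points = concatMap fromTriple triples

    ∈-points : ∀ P → P ∈ points
    ∈-points P = ∈-concatMap⁺ _ (Any.map (λ { refl → ∈-fromTriple P }) (∈-triples (value P)))

    orbit-isEquivalence : IsEquivalence (Orbit a)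
    orbit-isEquivalence = record
      { refl  = ↔-id _ , identity , refl
      ; sym   = λ { (g , g∈ , refl) → ↔-sym g , inverse g∈ , Inverse.strictlyInverseʳ g _ }
      ; trans = λ { (g , g∈ , refl) (h , h∈ , refl) → _ , compose h∈ g∈ , refl }
      }

    -- The induction principle for orbits: each invariant below is an instance of `R`. For an
    -- inverse, the hypothesis is applied at the preimage and reversed by symmetry.
    orbit-minimal : ∀ {R : Rel (S a) 0ℓ} → IsEquivalence R → (∀ j P → R P (m a j P)) →
                    ∀ {P Q} → Orbit a P Q → R P Q
    orbit-minimal {R} isEq step (g , g∈ , refl) = go g∈ _
      where
      open IsEquivalence isEq renaming (refl to R-refl; sym to R-sym; trans to R-trans)
      go : ∀ {g} → ⟨m⟩ a g → ∀ P → R P (Inverse.to g P)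
      go (generator j)       P = step j P
      go identity            P = R-refl
      go (compose g∈ h∈)     P = R-trans (go h∈ P) (go g∈ _)
      go (inverse {g} g∈)    P = R-sym (subst (R _) (Inverse.strictlyInverseˡ g P) (go g∈ _))

    edges : List (S a × S a)
    edges = cartesianProductWith (λ P j → P , m a j P) points (allFin 3)

    -- Both the orbit relation and connectedness along `edges` are the least equivalence containing
    -- the moves, so each contains the other, and connectedness is decidable.
    orbit? : Decidable₂ (Orbit a)
    orbit? P Q = Dec.map′
      (connected-minimal orbit-isEquivalence edges edges⊆orbit)
      (orbit-minimal connected-isEquivalence
        (λ j P → ∈⇒connected (∈-cartesianProductWith⁺ _ (∈-points P) (∈-allFin j))))
      (connected? _≟ₛ_ edges P Q)
      where
      connected-isEquivalence : IsEquivalence (Connected edges)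
      connected-isEquivalence = record
        { refl = connected-refl edges ; sym = connected-sym edges ; trans = connected-trans edges }
      edges⊆orbit : ∀ {P Q} → (P , Q) ∈ edges → Orbit a P Q
      edges⊆orbit e with ∈-cartesianProductWith⁻ _ points (allFin 3) e
      ... | P , j , _ , _ , refl = m↔ a j , generator j , refl

    orbitSetoid : DecSetoid 0ℓ 0ℓ
    orbitSetoid = record
      { isDecEquivalence = record { isEquivalence = orbit-isEquivalence ; _≟_ = orbit? } }

    module _ {U : Pred (S a) 0ℓ} (U? : Decidable U) (U-closed : ∀ j P → U P → U (m a j P))
             where

      private
        open IsEquivalence orbit-isEquivalence
          renaming (refl to orbit-refl; sym to orbit-sym; trans to orbit-trans)

        m-reflects-U : ∀ j P → U (m a j P) → U P
        m-reflects-U j P u = subst U (m-involutive a j P) (U-closed j _ u)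

        orbit-resp-U : ∀ {P Q} → Orbit a P Q → U P → U Q
        -- Preservation of `U` alone is not symmetric; the converse half comes from the moves being
        -- involutions.
        orbit-resp-U o = proj₁ (orbit-minimal {R = λ P Q → (U P → U Q) × (U Q → U P)}
          (record { refl = (λ u → u) , (λ u → u) ; sym = λ { (f , g) → g , f }
                  ; trans = λ { (f , g) (h , k) → h ∘ f , g ∘ k } })
          (λ j P → U-closed j P , m-reflects-U j P) o)

        reps : List (S a)
        reps = deduplicate orbit? (filter U? points)

        rep : Fin (length reps) → S a
        rep = List.lookup reps

        represented : ∀ {P} → U P → ∃[ i ] Orbit a (rep i) P
        represented {P} u = Any.index o , Any.lookup-index o
          where
          o : Any (λ Q → Orbit a Q P) reps
          o = Any.deduplicate⁺ orbit? (λ s r → orbit-trans s r)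
            (Any.map (λ { refl → orbit-refl }) (∈-filter⁺ U? (∈-points P) u))

        rep∈U : ∀ i → U (rep i)
        rep∈U i = proj₂ (∈-filter⁻ U? {xs = points} (∈-deduplicate⁻ orbit? _ (∈-lookup {xs = reps} i)))

      -- The orbits in `U` are represented by a deduplicated list. Sending `i` to the index of the
      -- representative of `w i` is injective because the `w i` lie in distinct orbits, which bounds
      -- the length below by `k`.
      atLeast-distinct : ∀ {k} (w : Fin k → S a) → (∀ i → U (w i)) →
        (∀ {i j} → Orbit a (w i) (w j) → i ≡ j) → UnionOfAtLeastOrbits a k U
      atLeast-distinct {k} w w∈U w-inj =
        length reps , injective⇒≤ index-injective , rep
        , (λ i≢j same → AllPairs-lookup (λ ¬o o → ¬o (orbit-sym o))
             (UniqueDec.deduplicate-! orbitSetoid (filter U? points)) i≢j (proj₂ same orbit-refl))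
        , represented
        , (λ { (i , o) → orbit-resp-U o (rep∈U i) })
        where
        index-injective : Injective _≡_ _≡_ (λ i → proj₁ (represented (w∈U i)))
        index-injective {i} {j} eq = w-inj (orbit-trans
          (orbit-sym (proj₂ (represented (w∈U i))))
          (subst (λ l → Orbit a (rep l) (w j)) (sym eq) (proj₂ (represented (w∈U j)))))

-- Counting orbits by the values of an invariant

module Counting {p : ℕ} .{{_ : NonZero p}} (a : Triple p) where

  open Residues p

  moveTriple-0 : ∀ j → moveTriple a j (replicate 3 ⌜ 0 ⌝) ≡ replicate 3 ⌜ 0 ⌝
  moveTriple-0 j = trans (cong (replicate 3 ⌜ 0 ⌝ [ j ]≔_) (newCoord-0 j)) (update-0 j)
    where
    vanishes : ∀ s b c → - ⌜ 0 ⌝ + s * ⌜ 0 ⌝ * ⌜ 0 ⌝ - b * ⌜ 0 ⌝ - c * ⌜ 0 ⌝ ≡ ⌜ 0 ⌝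
    vanishes = solve 3 (λ s b c → :- O :+ s :* O :* O :- b :* O :- c :* O := O) refl
      where O = lit 0
    newCoord-0 : ∀ j → newCoord a j (replicate 3 ⌜ 0 ⌝) ≡ ⌜ 0 ⌝
    newCoord-0 0F = vanishes (coeff-s a) (lookup a 1F) (lookup a 2F)
    newCoord-0 1F = vanishes (coeff-s a) (lookup a 2F) (lookup a 0F)
    newCoord-0 2F = vanishes (coeff-s a) (lookup a 0F) (lookup a 1F)
    update-0 : ∀ j → replicate 3 ⌜ 0 ⌝ [ j ]≔ ⌜ 0 ⌝ ≡ replicate 3 ⌜ 0 ⌝
    update-0 0F = refl
    update-0 1F = refl
    update-0 2F = refl

  S∖0-closed : ∀ j P → S∖0 a P → S∖0 a (m a j P)
  S∖0-closed j P P≢0 mP≡0 = P≢0 (trans (sym (moveTriple-involutive a j (value P)))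
    (trans (cong (moveTriple a j) mP≡0) (moveTriple-0 j)))

  atLeast-keys : ∀ {k} {K : Set} → Fin k ↔ K → (key : S a → K) →
    (∀ {P Q} → Orbit a P Q → key P ≡ key Q) →
    (∀ κ → ∃[ P ] S∖0 a P × key P ≡ κ) → UnionOfAtLeastOrbits a k (S∖0 a)
  atLeast-keys k↔K key key-orbit point =
    atLeast-distinct a (λ P → ¬? (Vec.≡-dec Fin._≟_ (value P) (replicate 3 ⌜ 0 ⌝))) S∖0-closed
      (λ i → proj₁ (w i)) (λ i → proj₁ (proj₂ (w i)))
      (λ {i} {j} o → Injection.injective (↔⇒↣ k↔K)
        (trans (sym (proj₂ (proj₂ (w i)))) (trans (key-orbit o) (proj₂ (proj₂ (w j))))))
    where
    w : ∀ i → ∃[ P ] S∖0 a P × key P ≡ Inverse.to k↔K i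
    w i = point (Inverse.to k↔K i)

-- The square class of a coordinate

module Cyclic {p : ℕ} .{{_ : NonZero p}} where

  open Residues p

  -- Shifting coefficients and coordinates cyclically together preserves the equation; reading it
  -- from index `i` lets one argument serve all three positions.
  CyclicEquation : Triple p → Fin 3 → Triple p → Set
  CyclicEquation a i x =
    let X = lookup x i ; Y = lookup x (next i) ; Z = lookup x (prev i) in
    X * X + Y * Y + Z * Z + lookup a i * Y * Z + lookup a (next i) * X * Z + lookup a (prev i) * X * Y
      ≡ coeff-s a * X * Y * Z

  solves≡cyclic : ∀ a i x → Solves a x ≡ CyclicEquation a i x
  solves≡cyclic (_ ∷ _ ∷ _ ∷ [])   0F (_ ∷ _ ∷ _ ∷ []) = refl
  solves≡cyclic a@(b ∷ c ∷ d ∷ []) 1F (x ∷ y ∷ z ∷ []) = cong₂ _≡_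
    (solve 6 (λ b c d x y z →
      x :* x :+ y :* y :+ z :* z :+ b :* y :* z :+ c :* x :* z :+ d :* x :* y
      := y :* y :+ z :* z :+ x :* x :+ c :* z :* x :+ d :* y :* x :+ b :* y :* z) refl b c d x y z)
    (solve 4 (λ s x y z → s :* x :* y :* z := s :* y :* z :* x) refl (coeff-s a) x y z)
  solves≡cyclic a@(b ∷ c ∷ d ∷ []) 2F (x ∷ y ∷ z ∷ []) = cong₂ _≡_
    (solve 6 (λ b c d x y z →
      x :* x :+ y :* y :+ z :* z :+ b :* y :* z :+ c :* x :* z :+ d :* x :* y
      := z :* z :+ x :* x :+ y :* y :+ d :* x :* y :+ b :* z :* y :+ c :* z :* x) refl b c d x y z)
    (solve 4 (λ s x y z → s :* x :* y :* z := s :* z :* x :* y) refl (coeff-s a) x y z)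

  place : Fin 3 → 𝔽 p → 𝔽 p → 𝔽 p → Triple p
  place 0F X Y Z = X ∷ Y ∷ Z ∷ []
  place 1F X Y Z = Z ∷ X ∷ Y ∷ []
  place 2F X Y Z = Y ∷ Z ∷ X ∷ []

  cyclic-place : ∀ a i X Y Z →
    X * X + Y * Y + Z * Z + lookup a i * Y * Z + lookup a (next i) * X * Z + lookup a (prev i) * X * Y
      ≡ coeff-s a * X * Y * Z → CyclicEquation a i (place i X Y Z)
  cyclic-place a 0F _ _ _ = id
  cyclic-place a 1F _ _ _ = id
  cyclic-place a 2F _ _ _ = id

  lookup-place : ∀ i X Y Z → lookup (place i X Y Z) i ≡ X
  lookup-place 0F _ _ _ = refl
  lookup-place 1F _ _ _ = refl
  lookup-place 2F _ _ _ = refl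

  lookup-place-prev : ∀ i X Y Z → lookup (place i X Y Z) (prev i) ≡ Z
  lookup-place-prev 0F _ _ _ = refl
  lookup-place-prev 1F _ _ _ = refl
  lookup-place-prev 2F _ _ _ = refl

module Invariant {p : ℕ} .{{_ : NonZero p}} (p-prime : Prime p)
  (a : Triple p) (i : Fin 3) (σ α : 𝔽 p) (σ²≡1 : σ * σ ≡ ⌜ 1 ⌝)
  (aᵢ : lookup a i ≡ ⌜ 2 ⌝ * σ) (aᵢ₋₁ : lookup a (prev i) ≡ α) (aᵢ₊₁ : lookup a (next i) ≡ α * σ)
  (s≢0 : coeff-s a ≢ ⌜ 0 ⌝) where

  open PrimeField p p-prime
  open Cyclic {p}

  private
    s : 𝔽 p
    s = coeff-s a

  Conic : 𝔽 p → 𝔽 p → 𝔽 p → Set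
  Conic X Y Z = X * X + α * X * (Y + σ * Z) + (Y + σ * Z) * (Y + σ * Z) ≡ s * X * Y * Z

  private
    completed : ∀ X Y Z {b c d} → b ≡ ⌜ 2 ⌝ * σ → c ≡ α → d ≡ α * σ →
      X * X + Y * Y + Z * Z + b * Y * Z + d * X * Z + c * X * Y
      ≡ X * X + α * X * (Y + σ * Z) + (Y + σ * Z) * (Y + σ * Z)
    completed X Y Z refl refl refl = begin
      X * X + Y * Y + Z * Z + ⌜ 2 ⌝ * σ * Y * Z + α * σ * X * Z + α * X * Y
        -- The solver treats σ as a free variable, so the defect (1 - σ²) Z² is kept explicit and
        -- removed by `σ²≡1`.
        ≡⟨ solve 5 (λ X Y Z α σ →
             X :* X :+ Y :* Y :+ Z :* Z :+ lit 2 :* σ :* Y :* Z :+ α :* σ :* X :* Z :+ α :* X :* Y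
             := X :* X :+ α :* X :* (Y :+ σ :* Z) :+ (Y :+ σ :* Z) :* (Y :+ σ :* Z) :+ (lit 1 :- σ :* σ) :* (Z :* Z))
             refl X Y Z α σ ⟩
      q + (⌜ 1 ⌝ - σ * σ) * (Z * Z)  ≡⟨ cong (λ z → q + (⌜ 1 ⌝ - z) * (Z * Z)) σ²≡1 ⟩
      q + (⌜ 1 ⌝ - ⌜ 1 ⌝) * (Z * Z)  ≡⟨ solve 2 (λ q Z → q :+ (lit 1 :- lit 1) :* (Z :* Z) := q) refl q Z ⟩
      q ∎
      where
      open ≡-Reasoning
      q = X * X + α * X * (Y + σ * Z) + (Y + σ * Z) * (Y + σ * Z)

  solves⇒conic : ∀ x → Solves a x → Conic (lookup x i) (lookup x (next i)) (lookup x (prev i))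
  solves⇒conic x eq = trans
    (sym (completed (lookup x i) (lookup x (next i)) (lookup x (prev i)) aᵢ aᵢ₋₁ aᵢ₊₁))
    (subst id (solves≡cyclic a i x) eq)

  conic⇒solves : ∀ X Y Z → Conic X Y Z → Solves a (place i X Y Z)
  conic⇒solves X Y Z eq = subst id (sym (solves≡cyclic a i (place i X Y Z)))
    (cyclic-place a i X Y Z (trans (completed X Y Z aᵢ aᵢ₋₁ aᵢ₊₁) eq))

  private
    c : 𝔽 p
    c = - (σ * s)

    -- A function of the decision rather than of `X`, so that `square-step` can split on the old and
    -- the new coordinate at once.
    pick : ∀ {X : 𝔽 p} → Dec (X ≡ ⌜ 0 ⌝) → 𝔽 p
    pick         (yes _) = c
    pick {X = X} (no  _) = X

    module _ (X Y Z X′ : 𝔽 p) (eq : Conic X Y Z)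
             (new : X′ ≡ - X + s * Z * Y - α * σ * Z - α * Y) where

      open ≡-Reasoning

      u : 𝔽 p
      u = Y + σ * Z

      vieta-product : X * X′ ≡ u * u
      vieta-product = x-y≡0⇒x≡y {X * X′} {u * u} (begin
        X * X′ - u * u
          ≡⟨ cong (λ w → X * w - u * u) new ⟩
        X * (- X + s * Z * Y - α * σ * Z - α * Y) - u * u
          ≡⟨ solve 6 (λ X Y Z s α σ → X :* (:- X :+ s :* Z :* Y :- α :* σ :* Z :- α :* Y) :- (Y :+ σ :* Z) :* (Y :+ σ :* Z)
               := :- ((X :* X :+ α :* X :* (Y :+ σ :* Z) :+ (Y :+ σ :* Z) :* (Y :+ σ :* Z)) :- s :* X :* Y :* Z))
               refl X Y Z s α σ ⟩
        - (X * X + α * X * u + u * u - s * X * Y * Z)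
          ≡⟨ cong (λ w → - w) (x≡y⇒x-y≡0 {X * X + α * X * u + u * u} {s * X * Y * Z} eq) ⟩
        - ⌜ 0 ⌝
          ≡⟨ -0#≈0# ⟩
        ⌜ 0 ⌝ ∎)

      -- The sum of the roots is s Y Z - α u. On u = 0 one has Y = -σ Z, which leaves -σ s Z²; this
      -- is the origin of `c`.
      vieta-sum-at-0 : u ≡ ⌜ 0 ⌝ → X + X′ ≡ c * (Z * Z)
      vieta-sum-at-0 u≡0 = begin
        X + X′
          ≡⟨ cong (X +_) new ⟩
        X + (- X + s * Z * Y - α * σ * Z - α * Y)
          ≡⟨ solve 6 (λ X Y Z s α σ → X :+ (:- X :+ s :* Z :* Y :- α :* σ :* Z :- α :* Y)
               := :- (σ :* s) :* (Z :* Z) :+ (s :* Z :- α) :* (Y :+ σ :* Z)) refl X Y Z s α σ ⟩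
        c * (Z * Z) + (s * Z - α) * u
          ≡⟨ cong (λ w → c * (Z * Z) + (s * Z - α) * w) u≡0 ⟩
        c * (Z * Z) + (s * Z - α) * ⌜ 0 ⌝
          ≡⟨ solve 2 (λ v w → v :+ w :* lit 0 := v) refl (c * (Z * Z)) (s * Z - α) ⟩
        c * (Z * Z) ∎

      c*Z² : ∀ {y} → y ≡ c * (Z * Z) → c * Z * (c * Z) ≡ c * y
      c*Z² refl = solve 2 (λ c Z → (c :* Z) :* (c :* Z) := c :* (c :* (Z :* Z))) refl c Z

      -- If exactly one root vanishes, the product forces u = 0, and the other root equals the whole
      -- sum c Z²; its product with `c` is (c Z)².
      square-step : (d : Dec (X ≡ ⌜ 0 ⌝)) (d′ : Dec (X′ ≡ ⌜ 0 ⌝)) → Square (pick d * pick d′)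
      square-step (yes _)   (yes _)    = c , refl
      square-step (no _)    (no _)     = u , sym vieta-product
      square-step (yes X≡0) (no _)     = c * Z , c*Z² (begin
        X′           ≡⟨ +-identityˡ X′ ⟨
        ⌜ 0 ⌝ + X′   ≡⟨ cong (_+ X′) X≡0 ⟨
        X + X′       ≡⟨ vieta-sum-at-0 (x*x≡0 {u} (trans (sym vieta-product)
                          (trans (cong (_* X′) X≡0) (zeroˡ X′)))) ⟩
        c * (Z * Z)  ∎)
      square-step (no _)    (yes X′≡0) = c * Z , trans (c*Z² (begin
        X            ≡⟨ +-identityʳ X ⟨
        X + ⌜ 0 ⌝    ≡⟨ cong (X +_) X′≡0 ⟨
        X + X′       ≡⟨ vieta-sum-at-0 (x*x≡0 {u} (trans (sym vieta-product)
                          (trans (cong (X *_) X′≡0) (zeroʳ X)))) ⟩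
        c * (Z * Z)  ∎)) (*-comm c X)

  φ : S a → 𝔽 p
  φ P = pick (lookup (value P) i Fin.≟ ⌜ 0 ⌝)

  private
    σ≢0 : σ ≢ ⌜ 0 ⌝
    σ≢0 σ≡0 = 1≢0 (trans (sym σ²≡1) (trans (cong (_* σ) σ≡0) (zeroˡ σ)))

    c≢0 : c ≢ ⌜ 0 ⌝
    c≢0 = -x≢0 (*-≢0 σ≢0 s≢0)

    pick≢0 : ∀ {X} (d : Dec (X ≡ ⌜ 0 ⌝)) → pick d ≢ ⌜ 0 ⌝
    pick≢0 (yes _)   = c≢0
    pick≢0 (no  X≢0) = X≢0

    pick-0 : ∀ {X} (d : Dec (X ≡ ⌜ 0 ⌝)) → X ≡ ⌜ 0 ⌝ → pick d ≡ c
    pick-0 (yes _)   _   = refl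
    pick-0 (no  X≢0) X≡0 = contradiction X≡0 X≢0

    pick-≢0 : ∀ {X} (d : Dec (X ≡ ⌜ 0 ⌝)) → X ≢ ⌜ 0 ⌝ → pick d ≡ X
    pick-≢0 (yes X≡0) X≢0 = contradiction X≡0 X≢0
    pick-≢0 (no  _)   _   = refl

    SameClass : S a → S a → Set
    SameClass P Q = Square (φ P * φ Q)

    φ≢0 : ∀ P → φ P ≢ ⌜ 0 ⌝
    φ≢0 P = pick≢0 (lookup (value P) i Fin.≟ ⌜ 0 ⌝)

    -- The factor y² is divided out. With y = 0 transitivity would fail, so `φ` has to avoid the
    -- value 0.
    square-trans : ∀ x y z → y ≢ ⌜ 0 ⌝ → Square (x * y) → Square (y * z) → Square (x * z)
    square-trans x y z y≢0 xy yz = square-cancelˡ {y * y} {x * z} (*-≢0 y≢0 y≢0) (y , refl)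
      (subst Square (solve 3 (λ x y z → (x :* y) :* (y :* z) := (y :* y) :* (x :* z)) refl x y z)
        (square-* xy yz))

    sameClass-isEquivalence : IsEquivalence SameClass
    sameClass-isEquivalence = record
      { refl  = λ {P} → φ P , refl
      ; sym   = λ {P} {Q} → subst Square (*-comm (φ P) (φ Q))
      ; trans = λ {P} {Q} {R} → square-trans (φ P) (φ Q) (φ R) (φ≢0 Q)
      }

    sameClass-m : ∀ j P → SameClass P (m a j P)
    sameClass-m j P@(x , [ x∈S ]) = step j (j Fin.≟ i)
      where
      step : ∀ j → Dec (j ≡ i) → SameClass P (m a j P)
      step j (yes refl) = square-step X Y Z (lookup (moveTriple a i x) i)
        (solves⇒conic x (recompute (solves? a x) x∈S))
        (trans (Vec.lookup∘updateAt i x)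
          (cong₂ (λ b d → - X + s * Z * Y - b * Z - d * Y) aᵢ₊₁ aᵢ₋₁))
        (X Fin.≟ ⌜ 0 ⌝) (lookup (moveTriple a i x) i Fin.≟ ⌜ 0 ⌝)
        where
        X = lookup x i
        Y = lookup x (next i)
        Z = lookup x (prev i)
      step j (no j≢i) = φ P , cong {A = 𝔽 p} (λ X → φ P * pick (X Fin.≟ ⌜ 0 ⌝))
        (sym (Vec.lookup∘updateAt′ i j (j≢i ∘ sym) x))

  -- Measuring the class relative to `c` gives every point with vanishing i-th coordinate the key
  -- `true`, whatever the class of `s`.
  key : S a → Bool
  key P = does (square? (c * φ P))

  key-orbit : ∀ {P Q} → Orbit a P Q → key P ≡ key Q
  key-orbit {P} {Q} o = does-⇔ (mk⇔
    (λ cP → square-trans c (φ P) (φ Q) (φ≢0 P) cP same)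
    (λ cQ → square-trans c (φ Q) (φ P) (φ≢0 Q) cQ (subst Square (*-comm (φ P) (φ Q)) same)))
    (square? (c * φ P)) (square? (c * φ Q))
    where
    same : SameClass P Q
    same = orbit-minimal a sameClass-isEquivalence sameClass-m o

  key-vanishing : ∀ P → lookup (value P) i ≡ ⌜ 0 ⌝ → key P ≡ true
  key-vanishing P X≡0 = dec-true (square? (c * φ P))
    (subst (λ z → Square (c * z)) (sym (pick-0 (lookup (value P) i Fin.≟ ⌜ 0 ⌝) X≡0)) (c , refl))

  key-of : ∀ P g y → g ≢ ⌜ 0 ⌝ → y ≢ ⌜ 0 ⌝ → - (σ * s) * lookup (value P) i ≡ g * g * y →
           key P ≡ does (square? y)
  key-of P g y g≢0 y≢0 cX≡ = trans
    (cong (λ z → does (square? z)) (trans (cong (c *_) (pick-≢0 (X Fin.≟ ⌜ 0 ⌝) X≢0)) cX≡))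
    (does-⇔ (mk⇔ (square-cancelˡ (*-≢0 g≢0 g≢0) (g , refl)) (square-* (g , refl)))
      (square? (g * g * y)) (square? y))
    where
    X : 𝔽 p
    X = lookup (value P) i
    X≢0 : X ≢ ⌜ 0 ⌝
    X≢0 X≡0 = *-≢0 (*-≢0 g≢0 g≢0) y≢0 (trans (sym cX≡) (trans (cong (c *_) X≡0) (zeroʳ c)))

  -- At x_i = 0 the equation collapses to (Y + σ Z)² = 0, whose solutions form the line Y = -σ Z.
  zeroPoint : 𝔽 p → S a
  zeroPoint z = place i ⌜ 0 ⌝ (- (σ * z)) z , [ conic⇒solves ⌜ 0 ⌝ (- (σ * z)) z
    (solve 4 (λ α σ s z → O :* O :+ α :* O :* (:- (σ :* z) :+ σ :* z) :+ (:- (σ :* z) :+ σ :* z) :* (:- (σ :* z) :+ σ :* z)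
      := s :* O :* :- (σ :* z) :* z) refl α σ s z) ]
    where O = lit 0

  zeroPoint≢0 : ∀ z → z ≢ ⌜ 0 ⌝ → S∖0 a (zeroPoint z)
  zeroPoint≢0 z z≢0 eq = z≢0 (trans (sym (lookup-place-prev i ⌜ 0 ⌝ (- (σ * z)) z))
    (trans (cong (λ x → lookup x (prev i)) eq) (Vec.lookup-replicate (prev i) ⌜ 0 ⌝)))

  key-zeroPoint : ∀ z → key (zeroPoint z) ≡ true
  key-zeroPoint z = key-vanishing (zeroPoint z) (lookup-place i ⌜ 0 ⌝ (- (σ * z)) z)

  -- The points of class y = r² - 1 on the slice x_i = t, with t y = -4 / (σ s):
  -- the discriminant of the slice, a quadratic in x_{i+1}, then has a square
  -- leading coefficient, and is made a square by completing that leading term.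
  private
    module _ (r D h ρ K : 𝔽 p) (dD≡1 : (r * r - ⌜ 1 ⌝) * D ≡ ⌜ 1 ⌝) (2h≡1 : ⌜ 2 ⌝ * h ≡ ⌜ 1 ⌝)
             (rρ≡1 : r * ρ ≡ ⌜ 1 ⌝) (cK≡1 : σ * s * K ≡ ⌜ 1 ⌝) where

      open ≡-Reasoning

      -- With u = X U and σ s Y = A the equation becomes 4 (U² + (α - A) U + 1) = (r² - 1) A². As a
      -- quadratic in 2 U it is solvable once r² A² - 2 α A + α² - 4 is a square. Equating this with
      -- (r A - l)² is linear in A, with coefficient 2 (r l - α); the choice r l = α + 1 makes that
      -- coefficient 2, and `B` is then the root 2 U.
      l A B U X Y Z : 𝔽 p
      l = (α + ⌜ 1 ⌝) * ρ
      A = h * (l * l - α * α + ⌜ 4 ⌝)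
      B = A - α + r * A - l
      U = h * B
      X = - (⌜ 4 ⌝ * D * K)
      Y = A * K
      -- Since σ is its own inverse, this solves Y + σ Z = X U for Z.
      Z = σ * (X * U - Y)

      half : ∀ x → ⌜ 2 ⌝ * (h * x) ≡ x
      half x = begin
        ⌜ 2 ⌝ * (h * x)  ≡⟨ solve 2 (λ h x → lit 2 :* (h :* x) := (lit 2 :* h) :* x) refl h x ⟩
        ⌜ 2 ⌝ * h * x    ≡⟨ cong (_* x) 2h≡1 ⟩
        ⌜ 1 ⌝ * x        ≡⟨ *-identityˡ x ⟩
        x                ∎

      rl : r * l ≡ α + ⌜ 1 ⌝
      rl = begin
        r * ((α + ⌜ 1 ⌝) * ρ)    ≡⟨ solve 3 (λ r α ρ → r :* ((α :+ lit 1) :* ρ) := (r :* ρ) :* (α :+ lit 1)) refl r α ρ ⟩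
        r * ρ * (α + ⌜ 1 ⌝)      ≡⟨ cong (_* (α + ⌜ 1 ⌝)) rρ≡1 ⟩
        ⌜ 1 ⌝ * (α + ⌜ 1 ⌝)      ≡⟨ *-identityˡ (α + ⌜ 1 ⌝) ⟩
        α + ⌜ 1 ⌝                ∎

      W : 𝔽 p
      W = ⌜ 1 ⌝ + α * U + U * U - A * U

      -- Completing the square, 4 W = (2 U + α - A)² - (A - α)² + 4, and the first bracket is r A -
      -- l. What remains besides (r² - 1) A² is l² - α² + 4 - 2 A (r l - α), which vanishes by the
      -- choice of `l` and `A`.
      4W≡ : ⌜ 4 ⌝ * W ≡ (r * r - ⌜ 1 ⌝) * (A * A)
      4W≡ = begin
        ⌜ 4 ⌝ * W
          ≡⟨ solve 3 (λ α U A → lit 4 :* (lit 1 :+ α :* U :+ U :* U :- A :* U)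
               := (lit 2 :* U) :* (lit 2 :* U :+ lit 2 :* α :- lit 2 :* A) :+ lit 4) refl α U A ⟩
        ⌜ 2 ⌝ * U * (⌜ 2 ⌝ * U + ⌜ 2 ⌝ * α - ⌜ 2 ⌝ * A) + ⌜ 4 ⌝
          ≡⟨ cong (λ v → v * (v + ⌜ 2 ⌝ * α - ⌜ 2 ⌝ * A) + ⌜ 4 ⌝) (half B) ⟩
        B * (B + ⌜ 2 ⌝ * α - ⌜ 2 ⌝ * A) + ⌜ 4 ⌝
          ≡⟨ solve 4 (λ A α r l → let B = A :- α :+ r :* A :- l in
               B :* (B :+ lit 2 :* α :- lit 2 :* A) :+ lit 4
               := (r :* r :- lit 1) :* (A :* A) :+ (l :* l :- α :* α :+ lit 4)
                  :- (lit 2 :* A) :* (r :* l :- α)) refl A α r l ⟩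
        (r * r - ⌜ 1 ⌝) * (A * A) + q - ⌜ 2 ⌝ * A * (r * l - α)
          ≡⟨ cong₂ (λ v w → (r * r - ⌜ 1 ⌝) * (A * A) + q - v * (w - α)) (half q) rl ⟩
        (r * r - ⌜ 1 ⌝) * (A * A) + q - q * (α + ⌜ 1 ⌝ - α)
          ≡⟨ solve 3 (λ v q α → v :+ q :- q :* (α :+ lit 1 :- α) := v) refl ((r * r - ⌜ 1 ⌝) * (A * A)) q α ⟩
        (r * r - ⌜ 1 ⌝) * (A * A) ∎
        where q = l * l - α * α + ⌜ 4 ⌝

      XW≡ : X * W ≡ - (A * A * K)
      XW≡ = begin
        - (⌜ 4 ⌝ * D * K) * W
          ≡⟨ solve 3 (λ D K W → :- (lit 4 :* D :* K) :* W := :- (D :* (lit 4 :* W) :* K)) refl D K W ⟩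
        - (D * (⌜ 4 ⌝ * W) * K)
          ≡⟨ cong (λ v → - (D * v * K)) 4W≡ ⟩
        - (D * ((r * r - ⌜ 1 ⌝) * (A * A)) * K)
          ≡⟨ solve 4 (λ D d A K → :- (D :* (d :* (A :* A)) :* K) := :- (d :* D :* (A :* A) :* K)) refl D (r * r - ⌜ 1 ⌝) A K ⟩
        - ((r * r - ⌜ 1 ⌝) * D * (A * A) * K)
          ≡⟨ cong (λ v → - (v * (A * A) * K)) dD≡1 ⟩
        - (⌜ 1 ⌝ * (A * A) * K)
          ≡⟨ solve 2 (λ A K → :- (lit 1 :* (A :* A) :* K) := :- (A :* A :* K)) refl A K ⟩
        - (A * A * K) ∎

      u≡XU : Y + σ * Z ≡ X * U
      u≡XU = begin
        Y + σ * (σ * (X * U - Y))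
          ≡⟨ solve 3 (λ Y σ v → Y :+ σ :* (σ :* (v :- Y)) := Y :+ (σ :* σ) :* (v :- Y)) refl Y σ (X * U) ⟩
        Y + σ * σ * (X * U - Y)
          ≡⟨ cong (λ v → Y + v * (X * U - Y)) σ²≡1 ⟩
        Y + ⌜ 1 ⌝ * (X * U - Y)
          ≡⟨ solve 2 (λ Y v → Y :+ lit 1 :* (v :- Y) := v) refl Y (X * U) ⟩
        X * U ∎

      slice : Conic X Y Z
      slice = begin
        X * X + α * X * (Y + σ * Z) + (Y + σ * Z) * (Y + σ * Z)
          ≡⟨ cong (λ u → X * X + α * X * u + u * u) u≡XU ⟩
        X * X + α * X * (X * U) + X * U * (X * U)
          ≡⟨ solve 4 (λ X α U A → X :* X :+ α :* X :* (X :* U) :+ X :* U :* (X :* U)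
               := X :* (X :* (lit 1 :+ α :* U :+ U :* U :- A :* U) :+ A :* (X :* U))) refl X α U A ⟩
        X * (X * W + A * (X * U))
          ≡⟨ cong (λ v → X * (v + A * (X * U))) XW≡ ⟩
        X * (- (A * A * K) + A * (X * U))
          ≡⟨ solve 4 (λ X A K v → X :* (:- (A :* A :* K) :+ A :* v) := lit 1 :* (X :* A :* (v :- A :* K))) refl X A K (X * U) ⟩
        ⌜ 1 ⌝ * (X * A * (X * U - Y))
          -- Expanding 1 as σ s K creates the factor `s` of the right-hand side; K is absorbed by Y
          -- and σ by Z.
          ≡⟨ cong (_* (X * A * (X * U - Y))) cK≡1 ⟨
        σ * s * K * (X * A * (X * U - Y))
          ≡⟨ solve 6 (λ σ s K X A v → σ :* s :* K :* (X :* A :* (v :- A :* K))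
               := s :* X :* (A :* K) :* (σ :* (v :- A :* K))) refl σ s K X A (X * U) ⟩
        s * X * Y * Z ∎

      slicePoint : S a
      slicePoint = place i X Y Z , [ conic⇒solves X Y Z slice ]

      -- The left side is 4 D, and D = D² (r² - 1) has the class of its inverse r² - 1.
      cX≡ : - (σ * s) * lookup (place i X Y Z) i ≡ ⌜ 2 ⌝ * D * (⌜ 2 ⌝ * D) * (r * r - ⌜ 1 ⌝)
      cX≡ = begin
        - (σ * s) * lookup (place i X Y Z) i
          ≡⟨ cong (λ v → - (σ * s) * v) (lookup-place i X Y Z) ⟩
        - (σ * s) * - (⌜ 4 ⌝ * D * K)
          ≡⟨ solve 4 (λ σ s D K → :- (σ :* s) :* :- (lit 4 :* D :* K) := (lit 4 :* D) :* (σ :* s :* K)) refl σ s D K ⟩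
        ⌜ 4 ⌝ * D * (σ * s * K)
          ≡⟨ cong (λ v → ⌜ 4 ⌝ * D * v) (trans cK≡1 (sym dD≡1)) ⟩
        ⌜ 4 ⌝ * D * ((r * r - ⌜ 1 ⌝) * D)
          ≡⟨ solve 2 (λ D d → lit 4 :* D :* (d :* D) := lit 2 :* D :* (lit 2 :* D) :* d) refl D (r * r - ⌜ 1 ⌝) ⟩
        ⌜ 2 ⌝ * D * (⌜ 2 ⌝ * D) * (r * r - ⌜ 1 ⌝) ∎

      D≢0 : D ≢ ⌜ 0 ⌝
      D≢0 D≡0 = 1≢0 (trans (sym dD≡1) (trans (cong (λ z → (r * r - ⌜ 1 ⌝) * z) D≡0) (zeroʳ (r * r - ⌜ 1 ⌝))))

  key-false⇒≢0 : ∀ P → key P ≡ false → S∖0 a P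
  key-false⇒≢0 P key≡false P≡0 = contradiction (trans (sym key≡false) (key-vanishing P
    (trans (cong (λ x → lookup x i) P≡0) (Vec.lookup-replicate i ⌜ 0 ⌝)))) λ ()

  nonsquarePoint : ⌜ 2 ⌝ ≢ ⌜_⌝ {p} 0 → ⌜ 3 ⌝ ≢ ⌜_⌝ {p} 0 → ∃[ P ] S∖0 a P × key P ≡ false
  nonsquarePoint 2≢0 3≢0 =
    let (r , r≢0 , ns) = nonsquare-r²-1 2≢0 3≢0
        d≢0 = ¬square⇒≢0 ns
        (D , dD≡1) = inverse-of d≢0
        (h , 2h≡1) = inverse-of 2≢0
        (ρ , rρ≡1) = inverse-of r≢0
        (K , cK≡1) = inverse-of (*-≢0 σ≢0 s≢0)
        P = slicePoint r D h ρ K dD≡1 2h≡1 rρ≡1 cK≡1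
        key≡false = trans
          (key-of P (⌜ 2 ⌝ * D) (r * r - ⌜ 1 ⌝) (*-≢0 2≢0 (D≢0 r D h ρ K dD≡1 2h≡1 rρ≡1 cK≡1)) d≢0
            (cX≡ r D h ρ K dD≡1 2h≡1 rρ≡1 cK≡1))
          (dec-false (square? (r * r - ⌜ 1 ⌝)) ns)
    in P , key-false⇒≢0 P key≡false , key≡false

-- Coefficients ±2

-- The four coefficient triples are the (2 ε₁, 2 ε₂, 2 ε₁ ε₂) with signs ε₁, ε₂. Then `s` is 9 or 1,
-- a square q² in each case, so it drops out of the classes; r = 3 / q is kept to express 9 / s.
module FourOrbits {p : ℕ} .{{_ : NonZero p}} (p-prime : Prime p)
  (2≢0 : ⌜ 2 ⌝ ≢ ⌜_⌝ {p} 0) (3≢0 : ⌜ 3 ⌝ ≢ ⌜_⌝ {p} 0)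
  (a : Triple p) (ε₁ ε₂ q r : 𝔽 p) (ε₁²≡1 : ε₁ * ε₁ ≡ ⌜ 1 ⌝) (ε₂²≡1 : ε₂ * ε₂ ≡ ⌜ 1 ⌝)
  (a₁ : lookup a 0F ≡ ⌜ 2 ⌝ * ε₁) (a₂ : lookup a 1F ≡ ⌜ 2 ⌝ * ε₂)
  (a₃ : lookup a 2F ≡ ⌜ 2 ⌝ * (ε₁ * ε₂))
  (s≡q² : coeff-s a ≡ q * q) (rq≡3 : r * q ≡ ⌜ 3 ⌝) where

  open PrimeField p p-prime
  open Cyclic {p}
  open ≡-Reasoning

  private
    q≢0 : q ≢ ⌜ 0 ⌝
    q≢0 q≡0 = 3≢0 (trans (sym rq≡3) (trans (cong (λ z → r * z) q≡0) (zeroʳ r)))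

    s≢0 : coeff-s a ≢ ⌜ 0 ⌝
    s≢0 s≡0 = *-≢0 q≢0 q≢0 (trans (sym s≡q²) s≡0)

    ±1≢0 : ∀ {ε} → ε * ε ≡ ⌜ 1 ⌝ → ε ≢ ⌜ 0 ⌝
    ±1≢0 {ε} ε²≡1 ε≡0 = 1≢0 (trans (sym ε²≡1) (trans (cong (_* ε) ε≡0) (zeroˡ ε)))

    ε₃²≡1 : ε₁ * ε₂ * (ε₁ * ε₂) ≡ ⌜ 1 ⌝
    ε₃²≡1 = begin
      ε₁ * ε₂ * (ε₁ * ε₂)      ≡⟨ solve 2 (λ e f → e :* f :* (e :* f) := (e :* e) :* (f :* f)) refl ε₁ ε₂ ⟩
      ε₁ * ε₁ * (ε₂ * ε₂)      ≡⟨ cong₂ _*_ ε₁²≡1 ε₂²≡1 ⟩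
      ⌜ 1 ⌝ * ⌜ 1 ⌝            ≡⟨ *-identityˡ ⌜ 1 ⌝ ⟩
      ⌜ 1 ⌝                    ∎

    -- As the third sign is the product of the other two, each index meets the hypotheses of
    -- `Invariant`, with its own sign as σ and the preceding coefficient as α.
    next₁ : lookup a 1F ≡ lookup a 2F * ε₁
    next₁ = begin
      lookup a 1F                                ≡⟨ a₂ ⟩
      ⌜ 2 ⌝ * ε₂                                 ≡⟨ *-identityʳ (⌜ 2 ⌝ * ε₂) ⟨
      ⌜ 2 ⌝ * ε₂ * ⌜ 1 ⌝                         ≡⟨ cong (λ e → ⌜ 2 ⌝ * ε₂ * e) ε₁²≡1 ⟨
      ⌜ 2 ⌝ * ε₂ * (ε₁ * ε₁)                     ≡⟨ solve 2 (λ e f → lit 2 :* f :* (e :* e) := lit 2 :* (e :* f) :* e) refl ε₁ ε₂ ⟩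
      ⌜ 2 ⌝ * (ε₁ * ε₂) * ε₁                     ≡⟨ cong (_* ε₁) a₃ ⟨
      lookup a 2F * ε₁                           ∎

    module I₁ = Invariant p-prime a 0F ε₁ (lookup a 2F) ε₁²≡1 a₁ refl next₁ s≢0

    next₂ : lookup a 2F ≡ lookup a 0F * ε₂
    next₂ = begin
      lookup a 2F                                ≡⟨ a₃ ⟩
      ⌜ 2 ⌝ * (ε₁ * ε₂)                          ≡⟨ *-assoc ⌜ 2 ⌝ ε₁ ε₂ ⟨
      ⌜ 2 ⌝ * ε₁ * ε₂                            ≡⟨ cong (_* ε₂) a₁ ⟨
      lookup a 0F * ε₂                           ∎

    module I₂ = Invariant p-prime a 1F ε₂ (lookup a 0F) ε₂²≡1 a₂ refl next₂ s≢0

    next₃ : lookup a 0F ≡ lookup a 1F * (ε₁ * ε₂)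
    next₃ = begin
      lookup a 0F                                ≡⟨ a₁ ⟩
      ⌜ 2 ⌝ * ε₁                                 ≡⟨ *-identityʳ (⌜ 2 ⌝ * ε₁) ⟨
      ⌜ 2 ⌝ * ε₁ * ⌜ 1 ⌝                         ≡⟨ cong (λ e → ⌜ 2 ⌝ * ε₁ * e) ε₂²≡1 ⟨
      ⌜ 2 ⌝ * ε₁ * (ε₂ * ε₂)                     ≡⟨ solve 2 (λ e f → lit 2 :* e :* (f :* f) := lit 2 :* f :* (e :* f)) refl ε₁ ε₂ ⟩
      ⌜ 2 ⌝ * ε₂ * (ε₁ * ε₂)                     ≡⟨ cong (_* (ε₁ * ε₂)) a₂ ⟨
      lookup a 1F * (ε₁ * ε₂)                    ∎

    module I₃ = Invariant p-prime a 2F (ε₁ * ε₂) (lookup a 1F) ε₃²≡1 a₃ refl next₃ s≢0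

    s = coeff-s a

    s*y≡q²y : ∀ y {w} → w ≡ ⌜ 1 ⌝ → s * y * w ≡ q * q * y
    s*y≡q²y y {w} w≡1 = begin
      s * y * w            ≡⟨ cong₂ (λ t w → t * y * w) s≡q² w≡1 ⟩
      q * q * y * ⌜ 1 ⌝    ≡⟨ *-identityʳ (q * q * y) ⟩
      q * q * y            ∎

    key : S a → Bool × Bool
    key P = I₁.key P , I₂.key P

    Point : Bool × Bool → Set
    Point κ = ∃[ P ] S∖0 a P × key P ≡ κ

    -- On the line x₂ = -ε₁ x₃ the parameter is scaled by signs so that -ε₂ s x₂ = q² y; the second
    -- class is then freely prescribed by `y`.
    point-on-x₁=0 : ∀ y → y ≢ ⌜ 0 ⌝ → Point (true , does (square? y))
    point-on-x₁=0 y y≢0 = I₁.zeroPoint z , I₁.zeroPoint≢0 z (*-≢0 {ε₁ * ε₂} {y} (±1≢0 ε₃²≡1) y≢0)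
      , cong₂ _,_ (I₁.key-zeroPoint z) (I₂.key-of (I₁.zeroPoint z) q y q≢0 y≢0 (begin
        - (ε₂ * s) * - (ε₁ * z)         ≡⟨ solve 4 (λ s e f y → :- (f :* s) :* :- (e :* (e :* f :* y))
                                             := s :* y :* (e :* f :* (e :* f))) refl s ε₁ ε₂ y ⟩
        s * y * (ε₁ * ε₂ * (ε₁ * ε₂))   ≡⟨ s*y≡q²y y ε₃²≡1 ⟩
        q * q * y                       ∎))
      where z = ε₁ * ε₂ * y

    point-on-x₂=0 : ∀ y → y ≢ ⌜ 0 ⌝ → Point (does (square? y) , true)
    point-on-x₂=0 y y≢0 = I₂.zeroPoint z , I₂.zeroPoint≢0 z (-x≢0 {ε₁ * y} (*-≢0 {ε₁} {y} (±1≢0 ε₁²≡1) y≢0))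
      , cong₂ _,_ (I₁.key-of (I₂.zeroPoint z) q y q≢0 y≢0 (begin
        - (ε₁ * s) * - (ε₁ * y)         ≡⟨ solve 3 (λ s e y → :- (e :* s) :* :- (e :* y)
                                             := s :* y :* (e :* e)) refl s ε₁ y ⟩
        s * y * (ε₁ * ε₁)               ≡⟨ s*y≡q²y y ε₁²≡1 ⟩
        q * q * y                       ∎)) (I₂.key-zeroPoint z)
      where z = - (ε₁ * y)

    -- Here x₁ = -ε₁ y and x₂ = ε₂ y, so the two classes differ by that of -1.
    point-on-x₃=0 : ∀ y → y ≢ ⌜ 0 ⌝ → Point (does (square? y) , does (square? (- y)))
    point-on-x₃=0 y y≢0 = I₃.zeroPoint z , I₃.zeroPoint≢0 z (*-≢0 {ε₂} {y} (±1≢0 ε₂²≡1) y≢0)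
      , cong₂ _,_ (I₁.key-of (I₃.zeroPoint z) q y q≢0 y≢0 (begin
        - (ε₁ * s) * - (ε₁ * ε₂ * z)    ≡⟨ solve 4 (λ s e f y → :- (e :* s) :* :- (e :* f :* (f :* y))
                                             := s :* y :* (e :* f :* (e :* f))) refl s ε₁ ε₂ y ⟩
        s * y * (ε₁ * ε₂ * (ε₁ * ε₂))   ≡⟨ s*y≡q²y y ε₃²≡1 ⟩
        q * q * y                       ∎))
        (I₂.key-of (I₃.zeroPoint z) q (- y) q≢0 (-x≢0 {y} y≢0) (begin
        - (ε₂ * s) * (ε₂ * y)           ≡⟨ solve 3 (λ s f y → :- (f :* s) :* (f :* y)
                                             := s :* :- y :* (f :* f)) refl s ε₂ y ⟩
        s * - y * (ε₂ * ε₂)             ≡⟨ s*y≡q²y (- y) ε₂²≡1 ⟩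
        q * q * - y                     ∎))
      where z = ε₂ * y

    R = r * r

    s*R≡9 : s * R ≡ ⌜ 9 ⌝
    s*R≡9 = begin
      s * (r * r)          ≡⟨ cong (_* (r * r)) s≡q² ⟩
      q * q * (r * r)      ≡⟨ solve 2 (λ q r → q :* q :* (r :* r) := (r :* q) :* (r :* q)) refl q r ⟩
      r * q * (r * q)      ≡⟨ cong (λ w → w * w) rq≡3 ⟩
      ⌜ 3 ⌝ * ⌜ 3 ⌝        ≡⟨ ⌜⌝-* 3 3 ⟨
      ⌜ 9 ⌝                ∎

    -- All signs cancel: the left side is (1 + 1 + 1 + 2 + 2 + 2) R² and the right side s R³, whence
    -- R = 9 / s.
    diagonal : I₁.Conic (R * ε₁) (R * ε₂) (R * (ε₁ * ε₂))
    diagonal = begin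
      R * ε₁ * (R * ε₁) + lookup a 2F * (R * ε₁) * (R * ε₂ + ε₁ * (R * (ε₁ * ε₂)))
        + (R * ε₂ + ε₁ * (R * (ε₁ * ε₂))) * (R * ε₂ + ε₁ * (R * (ε₁ * ε₂)))
        ≡⟨ cong (λ α → R * ε₁ * (R * ε₁) + α * (R * ε₁) * (R * ε₂ + ε₁ * (R * (ε₁ * ε₂)))
             + (R * ε₂ + ε₁ * (R * (ε₁ * ε₂))) * (R * ε₂ + ε₁ * (R * (ε₁ * ε₂)))) a₃ ⟩
      R * ε₁ * (R * ε₁) + ⌜ 2 ⌝ * (ε₁ * ε₂) * (R * ε₁) * (R * ε₂ + ε₁ * (R * (ε₁ * ε₂)))
        + (R * ε₂ + ε₁ * (R * (ε₁ * ε₂))) * (R * ε₂ + ε₁ * (R * (ε₁ * ε₂)))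
        -- Grouped by ε₁² and ε₂², which then become 1 and leave 1 + 2 * 4 = 9.
        ≡⟨ solve 3 (λ R e f → R :* e :* (R :* e) :+ lit 2 :* (e :* f) :* (R :* e) :* (R :* f :+ e :* (R :* (e :* f)))
             :+ (R :* f :+ e :* (R :* (e :* f))) :* (R :* f :+ e :* (R :* (e :* f)))
             := R :* R :* ((e :* e) :+ (f :* f) :* (lit 1 :+ e :* e) :* (lit 1 :+ lit 3 :* (e :* e)))) refl R ε₁ ε₂ ⟩
      R * R * (ε₁ * ε₁ + ε₂ * ε₂ * (⌜ 1 ⌝ + ε₁ * ε₁) * (⌜ 1 ⌝ + ⌜ 3 ⌝ * (ε₁ * ε₁)))
        ≡⟨ cong₂ (λ e f → R * R * (e + f * (⌜ 1 ⌝ + e) * (⌜ 1 ⌝ + ⌜ 3 ⌝ * e))) ε₁²≡1 ε₂²≡1 ⟩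
      R * R * (⌜ 1 ⌝ + ⌜ 1 ⌝ * (⌜ 1 ⌝ + ⌜ 1 ⌝) * (⌜ 1 ⌝ + ⌜ 3 ⌝ * ⌜ 1 ⌝))
        ≡⟨ solve 1 (λ R → R :* R :* (lit 1 :+ lit 1 :* (lit 1 :+ lit 1) :* (lit 1 :+ lit 3 :* lit 1))
             := lit 9 :* R :* R :* lit 1) refl R ⟩
      ⌜ 9 ⌝ * R * R * ⌜ 1 ⌝
        ≡⟨ cong₂ (λ v w → v * R * R * w) s*R≡9 ε₃²≡1 ⟨
      s * R * R * R * (ε₁ * ε₂ * (ε₁ * ε₂))
        ≡⟨ solve 4 (λ s R e f → s :* R :* R :* R :* (e :* f :* (e :* f))
             := s :* (R :* e) :* (R :* f) :* (R :* (e :* f))) refl s R ε₁ ε₂ ⟩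
      s * (R * ε₁) * (R * ε₂) * (R * (ε₁ * ε₂)) ∎

    -- At both indices -ε s R ε = -9, so each class is that of -1.
    diagonalPoint : ¬ Square (- ⌜ 1 ⌝) → Point (false , false)
    diagonalPoint ns = P , I₁.key-false⇒≢0 P key₁ , cong₂ _,_ key₁ key₂
      where
      P : S a
      P = place 0F (R * ε₁) (R * ε₂) (R * (ε₁ * ε₂))
        , [ I₁.conic⇒solves (R * ε₁) (R * ε₂) (R * (ε₁ * ε₂)) diagonal ]
      class : ∀ {ε} → ε * ε ≡ ⌜ 1 ⌝ → - (ε * s) * (R * ε) ≡ ⌜ 3 ⌝ * ⌜ 3 ⌝ * - ⌜ 1 ⌝
      class {ε} ε²≡1 = begin
        - (ε * s) * (R * ε)        ≡⟨ solve 3 (λ e s R → :- (e :* s) :* (R :* e) := :- (s :* R :* (e :* e))) refl ε s R ⟩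
        - (s * R * (ε * ε))        ≡⟨ cong₂ (λ v w → - (v * w)) s*R≡9 ε²≡1 ⟩
        - (⌜ 9 ⌝ * ⌜ 1 ⌝)          ≡⟨ solve 0 (:- (lit 9 :* lit 1) := lit 3 :* lit 3 :* :- lit 1) refl ⟩
        ⌜ 3 ⌝ * ⌜ 3 ⌝ * - ⌜ 1 ⌝    ∎
      key₁ : I₁.key P ≡ false
      key₁ = trans (I₁.key-of P ⌜ 3 ⌝ (- ⌜ 1 ⌝) 3≢0 (-x≢0 1≢0) (class ε₁²≡1)) (dec-false (square? (- ⌜ 1 ⌝)) ns)
      key₂ : I₂.key P ≡ false
      key₂ = trans (I₂.key-of P ⌜ 3 ⌝ (- ⌜ 1 ⌝) 3≢0 (-x≢0 1≢0) (class ε₂²≡1)) (dec-false (square? (- ⌜ 1 ⌝)) ns)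

    representative : ∀ b → ∃[ y ] y ≢ ⌜ 0 ⌝ × does (square? y) ≡ b
    representative true  = ⌜ 1 ⌝ , 1≢0 , dec-true (square? ⌜ 1 ⌝) (⌜ 1 ⌝ , *-identityˡ ⌜ 1 ⌝)
    representative false =
      let (n , ns) = nonsquare 2≢0 in n , ¬square⇒≢0 ns , dec-false (square? n) ns

    negated-nonsquare : ∀ n → Square (- ⌜ 1 ⌝) → ¬ Square n → ¬ Square (- n)
    negated-nonsquare n sq ns -n² = ns (square-cancelˡ (-x≢0 1≢0) sq
      (subst Square (solve 1 (λ n → :- n := :- lit 1 :* n) refl n) -n²))

    -- When -1 is a square, n and -n are nonsquares together, so the line in x₃ = 0 already carries
    -- this pair of classes.
    pointOffAxes : Dec (Square (- ⌜ 1 ⌝)) → Point (false , false)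
    pointOffAxes (no  ns) = diagonalPoint ns
    pointOffAxes (yes sq) =
      let (n , ns)        = nonsquare 2≢0
          (P , P≢0 , key≡) = point-on-x₃=0 n (¬square⇒≢0 ns)
      in P , P≢0 , trans key≡ (cong₂ _,_ (dec-false (square? n) ns)
           (dec-false (square? (- n)) (negated-nonsquare n sq ns)))

    point : ∀ κ → Point κ
    point (true , b) =
      let (y , y≢0 , y-class) = representative b
          (P , P≢0 , key≡)    = point-on-x₁=0 y y≢0
      in P , P≢0 , trans key≡ (cong (true ,_) y-class)
    point (false , true) =
      let (y , y≢0 , y-class) = representative false
          (P , P≢0 , key≡)    = point-on-x₂=0 y y≢0
      in P , P≢0 , trans key≡ (cong (_, true) y-class)
    point (false , false) = pointOffAxes (square? (- ⌜ 1 ⌝))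

  atLeastFour : UnionOfAtLeastOrbits a 4 (S∖0 a)
  atLeastFour = Counting.atLeast-keys a ((Fin.2↔Bool ×-↔ Fin.2↔Bool) ↔-∘ Fin.*↔× {2} {2})
    key (λ o → cong₂ _,_ (I₁.key-orbit o) (I₂.key-orbit o)) point

-- Primes above 3 and the four sign patterns

module Main (p : ℕ) .{{_ : NonZero p}} (p-prime : Prime p) (2∤p : 2 ∤ p) (p≢3 : p ≢ 3) where

  open PrimeField p p-prime
  open Cyclic {p}

  private
    p≢1 : p ≢ 1
    p≢1 = ℕ.nonTrivial⇒≢1 {{prime⇒nonTrivial p-prime}}

    2≢0 : ⌜ 2 ⌝ ≢ ⌜_⌝ {p} 0
    2≢0 2≡0 = [ p≢1 , (λ p≡2 → 2∤p (∣-reflexive (sym p≡2))) ]′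
      (prime⇒irreducible (from-yes (prime? 2)) (⌜⌝≡0⇒∣ 2≡0))

    3≢0 : ⌜ 3 ⌝ ≢ ⌜_⌝ {p} 0
    3≢0 3≡0 = [ p≢1 , p≢3 ]′ (prime⇒irreducible (from-yes (prime? 3)) (⌜⌝≡0⇒∣ 3≡0))

    1²≡1 : ⌜ 1 ⌝ * ⌜ 1 ⌝ ≡ ⌜_⌝ {p} 1
    1²≡1 = *-identityˡ ⌜ 1 ⌝

    -1²≡1 : - ⌜ 1 ⌝ * - ⌜ 1 ⌝ ≡ ⌜_⌝ {p} 1
    -1²≡1 = solve 0 (:- lit 1 :* :- lit 1 := lit 1) refl

  ±1²≡1 : ∀ {σ : 𝔽 p} → σ ≡ ⌜ 1 ⌝ ⊎ σ ≡ - ⌜ 1 ⌝ → σ * σ ≡ ⌜ 1 ⌝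
  ±1²≡1 (inj₁ refl) = 1²≡1
  ±1²≡1 (inj₂ refl) = -1²≡1

  module _ (a : Triple p) (i : Fin 3) (σ α : 𝔽 p) (σ²≡1 : σ * σ ≡ ⌜ 1 ⌝)
           (aᵢ : lookup a i ≡ ⌜ 2 ⌝ * σ) (aᵢ₋₁ : lookup a (prev i) ≡ α)
           (aᵢ₊₁ : lookup a (next i) ≡ α * σ) (s≢0 : coeff-s a ≢ ⌜ 0 ⌝) where

    private
      module I = Invariant p-prime a i σ α σ²≡1 aᵢ aᵢ₋₁ aᵢ₊₁ s≢0

    atLeastTwo : UnionOfAtLeastOrbits a 2 (S∖0 a)
    atLeastTwo = Counting.atLeast-keys a Fin.2↔Bool I.key I.key-orbit λ where
      true  → I.zeroPoint ⌜ 1 ⌝ , I.zeroPoint≢0 ⌜ 1 ⌝ 1≢0 , I.key-zeroPoint ⌜ 1 ⌝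
      false → I.nonsquarePoint 2≢0 3≢0

  signedTwos : List (Triple p)
  signedTwos = (⌜ 2 ⌝ ∷ ⌜ 2 ⌝ ∷ ⌜ 2 ⌝ ∷ []) ∷ (⌜ 2 ⌝ ∷ - ⌜ 2 ⌝ ∷ - ⌜ 2 ⌝ ∷ [])
    ∷ (- ⌜ 2 ⌝ ∷ ⌜ 2 ⌝ ∷ - ⌜ 2 ⌝ ∷ []) ∷ (- ⌜ 2 ⌝ ∷ - ⌜ 2 ⌝ ∷ ⌜ 2 ⌝ ∷ []) ∷ []

  private
    2≡ : ⌜ 2 ⌝ ≡ ⌜ 2 ⌝ * ⌜_⌝ {p} 1
    2≡ = sym (*-identityʳ ⌜ 2 ⌝)

    -2≡ : - ⌜ 2 ⌝ ≡ ⌜ 2 ⌝ * - ⌜_⌝ {p} 1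
    -2≡ = solve 0 (:- lit 2 := lit 2 :* :- lit 1) refl

    s≡1 : ⌜ 3 ⌝ + ⌜ 2 ⌝ - ⌜ 2 ⌝ - ⌜ 2 ⌝ ≡ ⌜ 1 ⌝ * ⌜_⌝ {p} 1
    s≡1 = solve 0 (lit 3 :+ lit 2 :- lit 2 :- lit 2 := lit 1 :* lit 1) refl

  atLeastFour : ∀ {a} → a ∈ signedTwos → UnionOfAtLeastOrbits a 4 (S∖0 a)
  atLeastFour (here refl) = FourOrbits.atLeastFour p-prime 2≢0 3≢0 _ ⌜ 1 ⌝ ⌜ 1 ⌝ ⌜ 3 ⌝ ⌜ 1 ⌝ 1²≡1 1²≡1
    2≡ 2≡ (solve 0 (lit 2 := lit 2 :* (lit 1 :* lit 1)) refl)
    (solve 0 (lit 3 :+ lit 2 :+ lit 2 :+ lit 2 := lit 3 :* lit 3) refl)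
    (*-identityˡ ⌜ 3 ⌝)
  atLeastFour (there (here refl)) = FourOrbits.atLeastFour p-prime 2≢0 3≢0 _ ⌜ 1 ⌝ (- ⌜ 1 ⌝) ⌜ 1 ⌝ ⌜ 3 ⌝ 1²≡1 -1²≡1
    2≡ -2≡ (solve 0 (:- lit 2 := lit 2 :* (lit 1 :* :- lit 1)) refl)
    s≡1 (*-identityʳ ⌜ 3 ⌝)
  atLeastFour (there (there (here refl))) = FourOrbits.atLeastFour p-prime 2≢0 3≢0 _ (- ⌜ 1 ⌝) ⌜ 1 ⌝ ⌜ 1 ⌝ ⌜ 3 ⌝ -1²≡1 1²≡1
    -2≡ 2≡ (solve 0 (:- lit 2 := lit 2 :* (:- lit 1 :* lit 1)) refl)
    (solve 0 (lit 3 :- lit 2 :+ lit 2 :- lit 2 := lit 1 :* lit 1) refl)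
    (*-identityʳ ⌜ 3 ⌝)
  atLeastFour (there (there (there (here refl)))) = FourOrbits.atLeastFour p-prime 2≢0 3≢0 _ (- ⌜ 1 ⌝) (- ⌜ 1 ⌝) ⌜ 1 ⌝ ⌜ 3 ⌝ -1²≡1 -1²≡1
    -2≡ -2≡ (solve 0 (lit 2 := lit 2 :* (:- lit 1 :* :- lit 1)) refl)
    (solve 0 (lit 3 :- lit 2 :- lit 2 :+ lit 2 := lit 1 :* lit 1) refl)
    (*-identityʳ ⌜ 3 ⌝)

  private
    place-lookup : ∀ (a : Triple p) i → place i (lookup a i) (lookup a (next i)) (lookup a (prev i)) ≡ a
    place-lookup (_ ∷ _ ∷ _ ∷ []) 0F = refl
    place-lookup (_ ∷ _ ∷ _ ∷ []) 1F = refl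
    place-lookup (_ ∷ _ ∷ _ ∷ []) 2F = refl

    2-2-2∈ : ∀ i → place i ⌜ 2 ⌝ ⌜ 2 ⌝ ⌜ 2 ⌝ ∈ signedTwos
    2-2-2∈ 0F = here refl
    2-2-2∈ 1F = here refl
    2-2-2∈ 2F = here refl

    2₋2₋2∈ : ∀ i → place i ⌜ 2 ⌝ (- ⌜ 2 ⌝) (- ⌜ 2 ⌝) ∈ signedTwos
    2₋2₋2∈ 0F = there (here refl)
    2₋2₋2∈ 1F = there (there (here refl))
    2₋2₋2∈ 2F = there (there (there (here refl)))

    place-next : ∀ i X Y Z → place i X Y Z ≡ place (next i) Y Z X
    place-next 0F _ _ _ = refl
    place-next 1F _ _ _ = refl
    place-next 2F _ _ _ = refl

    place-prev : ∀ i X Y Z → place i X Y Z ≡ place (prev i) Z X Y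
    place-prev 0F _ _ _ = refl
    place-prev 1F _ _ _ = refl
    place-prev 2F _ _ _ = refl

    at : ∀ i {X X′ Y Y′ Z} → X ≡ X′ → Y ≡ Y′ → place i X′ Y′ Z ∈ signedTwos → place i X Y Z ∈ signedTwos
    at i refl refl m = m

    -- Unless all three entries are 2, exactly one is written +2: it sits at `i` for σ = 1, and for
    -- σ = -1 at `prev i` or `next i` according to the sign of α. Rotating to that index reduces to
    -- `2₋2₋2∈`.
    placed∈ : ∀ i {σ α : 𝔽 p} → σ ≡ ⌜ 1 ⌝ ⊎ σ ≡ - ⌜ 1 ⌝ → α ≡ ⌜ 2 ⌝ ⊎ α ≡ - ⌜ 2 ⌝ →
              place i (⌜ 2 ⌝ * σ) (α * σ) α ∈ signedTwos
    placed∈ i (inj₁ refl) (inj₁ refl) = at i (sym 2≡) (sym 2≡) (2-2-2∈ i)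
    placed∈ i (inj₁ refl) (inj₂ refl) = at i (sym 2≡) (*-identityʳ (- ⌜ 2 ⌝)) (2₋2₋2∈ i)
    placed∈ i (inj₂ refl) (inj₁ refl) = at i (sym -2≡) (sym -2≡)
      (subst (_∈ signedTwos) (sym (place-prev i (- ⌜ 2 ⌝) (- ⌜ 2 ⌝) ⌜ 2 ⌝)) (2₋2₋2∈ (prev i)))
    placed∈ i (inj₂ refl) (inj₂ refl) = at i (sym -2≡)
      (solve 0 (:- lit 2 :* :- lit 1 := lit 2) refl)
      (subst (_∈ signedTwos) (sym (place-next i (- ⌜ 2 ⌝) ⌜ 2 ⌝ (- ⌜ 2 ⌝))) (2₋2₋2∈ (next i)))

  ∈signedTwos : ∀ a i {σ α : 𝔽 p} → σ ≡ ⌜ 1 ⌝ ⊎ σ ≡ - ⌜ 1 ⌝ → lookup a i ≡ ⌜ 2 ⌝ * σ →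
    lookup a (prev i) ≡ α → lookup a (next i) ≡ α * σ → α ≡ ⌜ 2 ⌝ ⊎ α ≡ - ⌜ 2 ⌝ → a ∈ signedTwos
  ∈signedTwos a i {σ} {α} σ≡±1 aᵢ aᵢ₋₁ aᵢ₊₁ α≡±2 = subst (_∈ signedTwos)
    (trans (sym (trans (cong₂ (λ X Y → place i X Y (lookup a (prev i))) aᵢ aᵢ₊₁)
      (cong (place i (⌜ 2 ⌝ * σ) (α * σ)) aᵢ₋₁))) (place-lookup a i))
    (placed∈ i σ≡±1 α≡±2)

theorem1p2 : (p : ℕ) .{{_ : NonZero p}} → Prime p → 2 ∤ p → p ≢ 3 →
    (σ α : 𝔽 p) (a : Triple p) (i : Fin 3) →
    σ ≡ ⌜ 1 ⌝ ⊎ σ ≡ - ⌜ 1 ⌝ →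
    lookup a i ≡ ⌜ 2 ⌝ * σ →
    lookup a (prev i) ≡ α →
    lookup a (next i) ≡ α * σ →
    coeff-s a ≢ ⌜ 0 ⌝ →
    UnionOfAtLeastOrbits a 2 (S∖0 a)
    × (α ≡ ⌜ 2 ⌝ ⊎ α ≡ - ⌜ 2 ⌝ →
    a ∈ (⌜ 2 ⌝ ∷ ⌜ 2 ⌝ ∷ ⌜ 2 ⌝ ∷ []) ∷ (⌜ 2 ⌝ ∷ - ⌜ 2 ⌝ ∷ - ⌜ 2 ⌝ ∷ [])
    ∷ (- ⌜ 2 ⌝ ∷ ⌜ 2 ⌝ ∷ - ⌜ 2 ⌝ ∷ []) ∷ (- ⌜ 2 ⌝ ∷ - ⌜ 2 ⌝ ∷ ⌜ 2 ⌝ ∷ []) ∷ []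
    × UnionOfAtLeastOrbits a 4 (S∖0 a))
theorem1p2 p p-prime 2∤p p≢3 σ α a i σ≡±1 aᵢ aᵢ₋₁ aᵢ₊₁ s≢0 =
  M.atLeastTwo a i σ α (M.±1²≡1 σ≡±1) aᵢ aᵢ₋₁ aᵢ₊₁ s≢0
  , λ α≡±2 → let a∈ = M.∈signedTwos a i σ≡±1 aᵢ aᵢ₋₁ aᵢ₊₁ α≡±2 in a∈ , M.atLeastFour a∈
  where
  module M = Main p p-prime 2∤p p≢3
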